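{- Let $s\geq 2$ be an integer congruent to $1$ or $2$ modulo $3$. Then \[\pi(S(K_s^{(2)}))\geq 1-\frac{2}{s},\] where $S(K_s^{(2)})$ is the suspension of the complete 2-graph on $s$ vertices and $\pi$ denotes Turán density.
   Context: A 3-graph is a pair $G=(V,E)$ with $V$ a finite vertex set and $E$ a set of 3-element subsets of $V$ (the 3-edges). A 3-graph contains another 3-graph $F$ as a subgraph if it has a (not necessarily induced) subgraph isomorphic to $F$. A 2-graph is an ordinary graph; $K_s^{(2)}$ is the complete 2-graph on $s$ vertices. For a 2-graph $H$, its suspension $S(H)$ is the 3-graph with vertex set $V(H)\sqcup\{x_\star\}$ and 3-edges $\{x_\star vv': vv'\in E(H)\}$. For a non-empty 3-graph $F$ (one having at least one 3-edge), the Turán number $\mathrm{ex}(n,F)$ is the maximum number of 3-edges in an $n$-vertex 3-graph not containing $F$ as a subgraph, and the Turán density is $\pi(F)=\lim_{n\to\infty}\mathrm{ex}(n,F)/\binom{n}{3}$ (the limit exists since the sequence is monotone decreasing). -}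

module Defs where

open import Data.Bool.Base using (true; false; if_then_else_)
open import Data.Fin.Base using (Fin; zero; suc; punchIn; punchOut; funToFin; finToFun)
open import Data.Fin.Properties using (any?; all?; finToFun-funToFin; punchIn-injective;
  punchIn-punchOut; punchInᵢ≢i) renaming (_≟_ to _≟ᶠ_)
open import Data.Fin.Subset using (Subset; inside; outside; ∣_∣; _∈_; _∉_; _⊆_)
open import Data.Fin.Subset.Properties using (_∈?_; ⊆-antisym)
open import Data.Integer.Base as ℤ using (+_; -[1+_])
import Data.Integer.Properties as ℤ
open import Data.List.Base using (List; []; _∷_; map; filter; length; _++_)
open import Data.List.Extrema.Nat using (argmax; argmax-all; f[xs]≤f[argmax])
open import Data.List.Membership.Propositional using () renaming (_∈_ to _∈ˡ_; _─_ to _─ˡ_)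
open import Data.List.Membership.Propositional.Properties using (∈-map⁺; ∈-map⁻; ∈-++⁺ˡ; ∈-++⁺ʳ;
  ∈-filter⁺; ∈-filter⁻)
open import Data.List.Properties using (length-map; map-∘; map-cong-local; map-id)
open import Data.List.Relation.Binary.Sublist.Propositional using ([]; _∷ʳ_; _∷_) renaming (_⊆_ to _⊑ˡ_)
open import Data.List.Relation.Binary.Sublist.Propositional.Properties using (All-resp-⊆)
open import Data.List.Relation.Unary.All as All using (All; []; _∷_)
import Data.List.Relation.Unary.All.Properties as All
open import Data.List.Relation.Unary.AllPairs as AllPairs using ([]; _∷_)
open import Data.List.Relation.Unary.Any as Any using (here; there)
open import Data.List.Relation.Unary.Unique.Propositional using (Unique)
import Data.List.Relation.Unary.Unique.Propositional.Properties as Unique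
open import Data.Nat.Base as ℕ using (ℕ; zero; suc; z≤n; s≤s; z<s)
open import Data.Nat.Combinatorics using (_C_; nC1≡n; nCk+nC[k+1]≡[n+1]C[k+1])
import Data.Nat.Properties as ℕ
open import Data.Nat.Solver using (module +-*-Solver)
open import Data.Product.Base using (∃; _×_; _,_; proj₁; proj₂)
open import Data.Rational.Base as ℚ using (ℚ; 0ℚ; _/_)
import Data.Rational.Properties as ℚ
import Data.Rational.Unnormalised.Base as ℚᵘ
import Data.Rational.Unnormalised.Properties as ℚᵘ
open import Data.Sum.Base using (inj₁; inj₂)
open import Data.Vec.Base using ([]; _∷_; lookup; tabulate; removeAt; insertAt; here; there)
open import Data.Vec.Properties using (≡-dec; lookup⇒[]=; []=⇒lookup; lookup∘tabulate;
  insertAt-removeAt; removeAt-punchOut; ∷-injectiveʳ)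
open import Data.Bool.Properties using () renaming (_≟_ to _≟ᵇ_)
open import Function.Base using (_∘_; const)
open import Function.Definitions using (Injective)
open import Relation.Binary.PropositionalEquality
open import Relation.Nullary using (¬_; Dec; yes; no; does; contradiction; ¬?; _×-dec_)
open import Relation.Nullary.Decidable using (map′; dec-true)
open import Algebra.Properties.Group ℚ.+-0-group using (⁻¹-anti-homo-//)
open import Algebra.Properties.CommutativeMonoid.Sum ℕ.+-0-commutativeMonoid
  using (sum; sum-cong-≗; ∑-distrib-+; sum-replicate-zero)

-- The edge set is a duplicate-free list; its order carries no meaning.
record Hypergraph (r n : ℕ) : Set where
  field
    edges   : List (Subset n)
    unique  : Unique edges
    uniform : All (λ e → ∣ e ∣ ≡ r) edges

  size : ℕ
  size = length edges

open Hypergraph public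

2-Graph 3-Graph : ℕ → Set
2-Graph = Hypergraph 2
3-Graph = Hypergraph 3

image : ∀ {m n} → (Fin m → Fin n) → Subset m → Subset n
image f p = tabulate λ y → does (any? λ x → (x ∈? p) ×-dec (f x ≟ᶠ y))

Copy : ∀ {m n} → List (Subset m) → List (Subset n) → Set
Copy es es′ = ∃ λ f → Injective _≡_ _≡_ f × All (λ e → image f e ∈ˡ es′) es

-- Not necessarily induced: f carries F isomorphically onto a subgraph of G.
infix 4 _⊑_

_⊑_ : ∀ {r m n} → Hypergraph r m → Hypergraph r n → Set
F ⊑ G = Copy (edges F) (edges G)

subsets : (r n : ℕ) → List (Subset n)
subsets zero    zero    = [] ∷ []
subsets (suc r) zero    = []
subsets zero    (suc n) = map (outside ∷_) (subsets zero n)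
subsets (suc r) (suc n) = map (inside ∷_) (subsets r n) ++ map (outside ∷_) (subsets (suc r) n)

subsets-sound : ∀ (r n : ℕ) → All (λ e → ∣ e ∣ ≡ r) (subsets r n)
subsets-sound zero    zero    = _∷_ {x = []} refl []
subsets-sound (suc r) zero    = []
subsets-sound zero    (suc n) = All.map⁺ {xs = subsets zero n} {f = outside ∷_} (subsets-sound zero n)
subsets-sound (suc r) (suc n) = All.++⁺
  (All.map⁺ (All.map (cong suc) (subsets-sound r n)))
  (All.map⁺ {xs = subsets (suc r) n} {f = outside ∷_} (subsets-sound (suc r) n))

subsets-complete : ∀ {n} (e : Subset n) → e ∈ˡ subsets ∣ e ∣ n
subsets-complete []                = here refl
subsets-complete (inside ∷ e)      = ∈-++⁺ˡ (∈-map⁺ (inside ∷_) (subsets-complete e))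
subsets-complete {suc n} (outside ∷ e) with ∣ e ∣ | subsets-complete e
... | zero  | e∈ = ∈-map⁺ (outside ∷_) e∈
... | suc r | e∈ = ∈-++⁺ʳ (map (inside ∷_) (subsets r n)) (∈-map⁺ (outside ∷_) e∈)

subsets-unique : ∀ (r n : ℕ) → Unique (subsets r n)
subsets-unique zero    zero    = [] ∷ []
subsets-unique (suc r) zero    = []
subsets-unique zero    (suc n) = Unique.map⁺ ∷-injectiveʳ (subsets-unique zero n)
subsets-unique (suc r) (suc n) = Unique.++⁺
  (Unique.map⁺ ∷-injectiveʳ (subsets-unique r n))
  (Unique.map⁺ ∷-injectiveʳ (subsets-unique (suc r) n))
  λ (e∈₁ , e∈₂) → disjoint (∈-map⁻ _ e∈₁) (∈-map⁻ _ e∈₂)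
  where
  disjoint : ∀ {e} {P Q : Subset n → Set} → ∃ (λ p → P p × e ≡ inside ∷ p) →
             ¬ ∃ (λ q → Q q × e ≡ outside ∷ q)
  disjoint (_ , _ , refl) (_ , _ , ())

complete : ∀ r n → Hypergraph r n
complete r n = record
  { edges   = subsets r n
  ; unique  = subsets-unique r n
  ; uniform = subsets-sound r n
  }

K⁽²⁾ : ∀ s → 2-Graph s
K⁽²⁾ = complete 2

-- The new vertex x⋆ is zero; the vertices of H are shifted by suc.
S : ∀ {m} → 2-Graph m → 3-Graph (suc m)
S H = record
  { edges   = map (inside ∷_) (edges H)
  ; unique  = Unique.map⁺ ∷-injectiveʳ (unique H)
  ; uniform = All.map⁺ (All.map (cong suc) (uniform H))
  }

NonEmpty : ∀ {r n} → Hypergraph r n → Set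
NonEmpty G = 0 ℕ.< size G

K⁽²⁾-nonEmpty : ∀ s → 2 ℕ.≤ s → NonEmpty (K⁽²⁾ s)
K⁽²⁾-nonEmpty (suc (suc s)) (s≤s (s≤s _)) = lemma s
  where
  positive : ∀ {n} {xs : List (Subset n)} {x} → x ∈ˡ xs → 0 ℕ.< length xs
  positive (here _)  = z<s
  positive (there _) = z<s
  empty : ∀ n → ∃ λ e → e ∈ˡ subsets 0 n
  empty zero    = _ , here refl
  empty (suc n) = _ , ∈-map⁺ _ (proj₂ (empty n))
  lemma : ∀ s → 0 ℕ.< length (subsets 2 (suc (suc s)))
  lemma s = positive (∈-++⁺ˡ (∈-map⁺ (inside ∷_) (∈-++⁺ˡ (∈-map⁺ (inside ∷_) (proj₂ (empty s))))))

S-nonEmpty : ∀ {m} (H : 2-Graph m) → NonEmpty H → NonEmpty (S H)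
S-nonEmpty H = subst (0 ℕ.<_) (sym (length-map (inside ∷_) (edges H)))

IsTuránNumber : ∀ {m} → 3-Graph m → ℕ → ℕ → Set
IsTuránNumber F n k =
  (∃ λ (G : 3-Graph n) → ¬ F ⊑ G × size G ≡ k) ×
  (∀ (G : 3-Graph n) → ¬ F ⊑ G → size G ℕ.≤ k)

module _ {n : ℕ} where

  infix 4 _∈ˡ?_

  _∈ˡ?_ : ∀ (e : Subset n) es → Dec (e ∈ˡ es)
  e ∈ˡ? es = Any.any? (≡-dec _≟ᵇ_ e) es

  ∈-image⁺ : ∀ {m} {f : Fin m → Fin n} {p x} → x ∈ p → f x ∈ image f p
  ∈-image⁺ {f = f} {p} {x} x∈p = lookup⇒[]= _ _
    (trans (lookup∘tabulate _ (f x)) (dec-true (any? _) (x , x∈p , refl)))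

  ∈-image⁻ : ∀ {m} {f : Fin m → Fin n} {p y} → y ∈ image f p → ∃ λ x → x ∈ p × f x ≡ y
  ∈-image⁻ {f = f} {p} {y} y∈ with any? (λ x → (x ∈? p) ×-dec (f x ≟ᶠ y))
                             | trans (sym (lookup∘tabulate _ y)) ([]=⇒lookup y∈)
  ... | yes h | _  = h
  ... | no  _ | ()

  image-cong : ∀ {m} {f g : Fin m → Fin n} → f ≗ g → ∀ p → image f p ≡ image g p
  image-cong {f = f} {g} f≗g p = ⊆-antisym (to f≗g) (to (sym ∘ f≗g))
    where
    to : ∀ {f g : Fin _ → Fin n} → f ≗ g → image f p ⊆ image g p
    to {f} {g} f≗g y∈ = let x , x∈p , fx≡y = ∈-image⁻ {f = f} y∈ in
      subst (_∈ image g p) (trans (sym (f≗g x)) fx≡y) (∈-image⁺ {f = g} x∈p)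

  copy? : ∀ {m} (es : List (Subset m)) (es′ : List (Subset n)) → Dec (Copy es es′)
  copy? {m} es es′ = map′ from to (any? λ i → P? (finToFun i))
    where
    P : (Fin m → Fin n) → Set
    P f = (∀ x y → f x ≡ f y → x ≡ y) × All (λ e → image f e ∈ˡ es′) es
    P? : ∀ f → Dec (P f)
    P? f = all? (λ x → all? λ y → imp (f x ≟ᶠ f y) (x ≟ᶠ y)) ×-dec All.all? (λ e → image f e ∈ˡ? es′) es
      where
      imp : ∀ {A B : Set} → Dec A → Dec B → Dec (A → B)
      imp _       (yes b) = yes λ _ → b
      imp (yes a) (no ¬b) = no λ f → ¬b (f a)
      imp (no ¬a) (no _)  = yes λ a → contradiction a ¬a
    from : ∃ (λ i → P (finToFun i)) → Copy es es′
    from (i , inj , h) = finToFun i , inj _ _ , h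
    to : Copy es es′ → ∃ λ i → P (finToFun i)
    to (f , inj , h) = funToFin f
      , (λ x y eq → inj (trans (sym (f≗ x)) (trans eq (f≗ y))))
      , All.map (λ {e} → subst (_∈ˡ es′) (image-cong (sym ∘ f≗) e)) h
      where
      f≗ : finToFun (funToFin f) ≗ f
      f≗ = finToFun-funToFin f

length-mono : ∀ {A : Set} {xs ys : List A} → Unique xs → (∀ {x} → x ∈ˡ xs → x ∈ˡ ys) →
              length xs ℕ.≤ length ys
length-mono {xs = []}     _          _  = z≤n
length-mono {xs = x ∷ xs} {ys} (x∉ ∷ u) xs⊆ys = ℕ.≤-trans
  (s≤s (length-mono u λ y∈ → keep (xs⊆ys (here refl)) (xs⊆ys (there y∈)) (All.lookup x∉ y∈)))
  (ℕ.≤-reflexive (shrink (xs⊆ys (here refl))))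
  where
  keep : ∀ {y ys} (x∈ : x ∈ˡ ys) → y ∈ˡ ys → x ≢ y → y ∈ˡ (ys ─ˡ x∈)
  keep (here refl) (here refl) x≢y = contradiction refl x≢y
  keep (here refl) (there y∈)  x≢y = y∈
  keep (there x∈)  (here refl) x≢y = here refl
  keep (there x∈)  (there y∈)  x≢y = there (keep x∈ y∈ x≢y)
  shrink : ∀ {ys} (x∈ : x ∈ˡ ys) → suc (length (ys ─ˡ x∈)) ≡ length ys
  shrink (here _)   = refl
  shrink (there x∈) = cong suc (shrink x∈)

module _ {A : Set} where

  sublists : List A → List (List A)
  sublists []       = [] ∷ []
  sublists (x ∷ xs) = map (x ∷_) (sublists xs) ++ sublists xs

  sublists-sound : ∀ xs → All (_⊑ˡ xs) (sublists xs)
  sublists-sound []       = [] ∷ []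
  sublists-sound (x ∷ xs) = All.++⁺
    (All.map⁺ (All.map (refl ∷_) (sublists-sound xs)))
    (All.map (x ∷ʳ_) (sublists-sound xs))

  filter∈sublists : ∀ {P : A → Set} (P? : ∀ x → Dec (P x)) xs → filter P? xs ∈ˡ sublists xs
  filter∈sublists P? []       = here refl
  filter∈sublists P? (x ∷ xs) with does (P? x)
  ... | true  = ∈-++⁺ˡ (∈-map⁺ (x ∷_) (filter∈sublists P? xs))
  ... | false = ∈-++⁺ʳ (map (x ∷_) (sublists xs)) (filter∈sublists P? xs)

  unique-resp-⊑ : ∀ {xs ys : List A} → xs ⊑ˡ ys → Unique ys → Unique xs
  unique-resp-⊑ []         u        = u
  unique-resp-⊑ (_ ∷ʳ s)   (_ ∷ u)  = unique-resp-⊑ s u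
  unique-resp-⊑ (refl ∷ s) (x∉ ∷ u) = All-resp-⊆ s x∉ ∷ unique-resp-⊑ s u

abstract
  turán-number : ∀ {m} (F : 3-Graph m) → NonEmpty F → ∀ n → ∃ (IsTuránNumber F n)
  turán-number F F≢∅ n = length best
    , (record { edges   = best
              ; unique  = unique-resp-⊑ (proj₁ best-good) (subsets-unique 3 n)
              ; uniform = All-resp-⊆ (proj₁ best-good) (subsets-sound 3 n) }
      , proj₂ best-good , refl)
    , bound
    where
    Free : List (Subset n) → Set
    Free es = ¬ Copy (edges F) es
    free? : ∀ es → Dec (Free es)
    free? es = ¬? (copy? (edges F) es)
    candidates : List (List (Subset n))
    candidates = filter free? (sublists (subsets 3 n))
    best : List (Subset n)
    best = argmax length [] candidates
    Good : List (Subset n) → Set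
    Good es = es ⊑ˡ subsets 3 n × Free es
    min⊑ : ∀ {xs : List (Subset n)} → [] ⊑ˡ xs
    min⊑ {[]}     = []
    min⊑ {x ∷ xs} = x ∷ʳ min⊑
    []-free : Free []
    []-free (f , _ , h) = no-copy f F≢∅ h
      where
      no-copy : ∀ {m} {es : List (Subset m)} (f : Fin m → Fin n) → 0 ℕ.< length es → ¬ All (λ e → image f e ∈ˡ []) es
      no-copy _ _ (() ∷ _)
    best-good : Good best
    best-good = argmax-all length (min⊑ , []-free)
      (All.tabulate λ es∈ → let es∈₁ , free = ∈-filter⁻ free? es∈ in
        All.lookup (sublists-sound (subsets 3 n)) es∈₁ , free)
    bound : ∀ (G : 3-Graph n) → ¬ F ⊑ G → size G ℕ.≤ length best
    bound G ¬F⊑G = ℕ.≤-trans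
      (length-mono (unique G) λ {e} e∈ → ∈-filter⁺ (_∈ˡ? edges G)
        (subst (λ r → e ∈ˡ subsets r n) (All.lookup (uniform G) e∈) (subsets-complete e)) e∈)
      (All.lookup (f[xs]≤f[argmax] {f = length} [] candidates)
        (∈-filter⁺ free? (filter∈sublists (_∈ˡ? edges G) (subsets 3 n))
          λ (f , inj , h) → ¬F⊑G (f , inj , All.map (proj₂ ∘ ∈-filter⁻ (_∈ˡ? edges G) {xs = subsets 3 n}) h)))

ex : ∀ {m} → ℕ → (F : 3-Graph m) → NonEmpty F → ℕ
ex n F F≢∅ = proj₁ (turán-number F F≢∅ n)

_∉?_ : ∀ {n} (v : Fin n) p → Dec (v ∉ p)
v ∉? p = ¬? (v ∈? p)

lookup-∉ : ∀ {n} {v : Fin n} {p} → v ∉ p → lookup p v ≡ outside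
lookup-∉ {v = v} {p} v∉p with lookup p v in eq
... | true  = contradiction (lookup⇒[]= v p eq) v∉p
... | false = refl

insert-remove : ∀ {n} {v : Fin (suc n)} {p} → v ∉ p → insertAt (removeAt p v) v outside ≡ p
insert-remove {v = v} {p} v∉p =
  trans (cong (insertAt (removeAt p v) v) (sym (lookup-∉ v∉p))) (insertAt-removeAt p v)

∣removeAt∣ : ∀ {n} {v : Fin (suc n)} {p} → v ∉ p → ∣ removeAt p v ∣ ≡ ∣ p ∣
∣removeAt∣ {v = zero}  {inside  ∷ p} v∉p = contradiction here v∉p
∣removeAt∣ {v = zero}  {outside ∷ p} v∉p = refl
∣removeAt∣ {suc n} {suc v} {inside  ∷ p@(_ ∷ _)} v∉p = cong suc (∣removeAt∣ {v = v} {p} (v∉p ∘ there))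
∣removeAt∣ {suc n} {suc v} {outside ∷ p@(_ ∷ _)} v∉p = ∣removeAt∣ {v = v} {p} (v∉p ∘ there)

lookup-removeAt : ∀ {n} {v : Fin (suc n)} {p : Subset (suc n)} {x} → lookup (removeAt p v) x ≡ lookup p (punchIn v x)
lookup-removeAt {v = v} {p} {x} = begin
  lookup (removeAt p v) x                ≡⟨ cong (lookup (removeAt p v)) eq ⟨
  lookup (removeAt p v) (punchOut v≢)    ≡⟨ removeAt-punchOut p v≢ ⟩
  lookup p (punchIn v x)                 ∎
  where
  open ≡-Reasoning
  v≢ : v ≢ punchIn v x
  v≢ = punchInᵢ≢i v x ∘ sym
  eq : punchOut v≢ ≡ x
  eq = punchIn-injective v _ _ (punchIn-punchOut v≢)

module _ {n : ℕ} (G : 3-Graph (suc n)) (v : Fin (suc n)) where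

  avoiding : List (Subset (suc n))
  avoiding = filter (v ∉?_) (edges G)

  avoid : All (v ∉_) avoiding
  avoid = All.all-filter (v ∉?_) (edges G)

  delete : 3-Graph n
  delete = record
    { edges   = map (λ p → removeAt p v) avoiding
    ; unique  = Unique.map⁻ (subst Unique (sym restore) (Unique.filter⁺ (v ∉?_) (unique G)))
    ; uniform = All.map⁺ (All.map (λ (v∉p , ∣p∣≡3) → trans (∣removeAt∣ v∉p) ∣p∣≡3)
        (All.zip (avoid , All.filter⁺ (v ∉?_) (uniform G))))
    }
    where
    restore : map (λ q → insertAt q v outside) (map (λ p → removeAt p v) avoiding) ≡ avoiding
    restore = trans (sym (map-∘ avoiding))
      (trans (map-cong-local (All.map insert-remove avoid)) (map-id avoiding))

  delete-free : ∀ {m} {F : 3-Graph m} → ¬ F ⊑ G → ¬ F ⊑ delete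
  delete-free ¬F⊑G (f , inj , h) = ¬F⊑G
    ( punchIn v ∘ f , (λ eq → inj (punchIn-injective v _ _ eq)) , All.map lift h )
    where
    lift : ∀ {e} → image f e ∈ˡ map (λ p → removeAt p v) avoiding → image (punchIn v ∘ f) e ∈ˡ edges G
    lift {e} i∈ with p , p∈ , eq ← ∈-map⁻ _ i∈ = subst (_∈ˡ edges G) (⊆-antisym ⊆₁ ⊆₂) p∈G
      where
      p∈G : p ∈ˡ edges G
      p∈G = proj₁ (∈-filter⁻ (v ∉?_) p∈)
      v∉p : v ∉ p
      v∉p = proj₂ (∈-filter⁻ (v ∉?_) {xs = edges G} p∈)
      ⊆₁ : p ⊆ image (punchIn v ∘ f) e
      ⊆₁ {y} y∈p with v ≟ᶠ y
      ... | yes refl = contradiction y∈p v∉p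
      ... | no v≢y =
        let z∈ : punchOut v≢y ∈ image f e
            z∈ = lookup⇒[]= _ _ (trans (cong (λ q → lookup q (punchOut v≢y)) eq)
                   (trans (removeAt-punchOut p v≢y) ([]=⇒lookup y∈p)))
            x , x∈e , fx≡ = ∈-image⁻ {f = f} z∈
        in subst (_∈ image (punchIn v ∘ f) e)
             (trans (cong (punchIn v) fx≡) (punchIn-punchOut v≢y)) (∈-image⁺ {f = punchIn v ∘ f} x∈e)
      ⊆₂ : image (punchIn v ∘ f) e ⊆ p
      ⊆₂ y∈ with x , x∈e , refl ← ∈-image⁻ {f = punchIn v ∘ f} y∈ =
        lookup⇒[]= _ _ (trans (sym (lookup-removeAt {v = v} {p} {f x}))
          (trans (cong (λ q → lookup q (f x)) (sym eq)) ([]=⇒lookup (∈-image⁺ {f = f} x∈e))))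

sum-mono : ∀ {n} {f : Fin n → ℕ} {k} → (∀ i → f i ℕ.≤ k) → sum f ℕ.≤ n ℕ.* k
sum-mono {zero}  h = z≤n
sum-mono {suc n} h = ℕ.+-mono-≤ (h zero) (sum-mono (h ∘ suc))

avoids : ∀ {n} → Subset n → Fin n → ℕ
avoids p v = if lookup p v then 0 else 1

sum-avoids : ∀ {n} (p : Subset n) → sum (avoids p) ℕ.+ ∣ p ∣ ≡ n
sum-avoids []            = refl
sum-avoids (inside  ∷ p) = trans (ℕ.+-suc _ ∣ p ∣) (cong suc (sum-avoids p))
sum-avoids (outside ∷ p) = cong suc (sum-avoids p)

length-avoiding : ∀ {n} (v : Fin n) p ps →
  length (filter (v ∉?_) (p ∷ ps)) ≡ avoids p v ℕ.+ length (filter (v ∉?_) ps)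
length-avoiding v p ps with v ∈? p
... | yes v∈p rewrite []=⇒lookup v∈p = refl
... | no  v∉p rewrite lookup-∉ v∉p   = refl

sum-avoiding : ∀ {n} (ps : List (Subset n)) → All (λ p → ∣ p ∣ ≡ 3) ps →
  sum (λ v → length (filter (v ∉?_) ps)) ℕ.+ 3 ℕ.* length ps ≡ n ℕ.* length ps
sum-avoiding {n} [] [] = trans (cong (ℕ._+ 0) (sum-replicate-zero n)) (sym (ℕ.*-zeroʳ n))
sum-avoiding {n} (p ∷ ps) (∣p∣≡3 ∷ h) = begin
  sum (λ v → length (filter (v ∉?_) (p ∷ ps))) ℕ.+ 3 ℕ.* suc l
    ≡⟨ cong (ℕ._+ 3 ℕ.* suc l) (trans (sum-cong-≗ λ v → length-avoiding v p ps) (∑-distrib-+ (avoids p) rest)) ⟩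
  (sum (avoids p) ℕ.+ sum rest) ℕ.+ 3 ℕ.* suc l
    ≡⟨ solve 3 (λ a b l → (a :+ b) :+ con 3 :* (con 1 :+ l) := (a :+ con 3) :+ (b :+ con 3 :* l)) refl (sum (avoids p)) (sum rest) l ⟩
  (sum (avoids p) ℕ.+ 3) ℕ.+ (sum rest ℕ.+ 3 ℕ.* l)
    ≡⟨ cong₂ ℕ._+_ (trans (cong (sum (avoids p) ℕ.+_) (sym ∣p∣≡3)) (sum-avoids p)) (sum-avoiding ps h) ⟩
  n ℕ.+ n ℕ.* l
    ≡⟨ ℕ.*-suc n l ⟨
  n ℕ.* suc l ∎
  where
  open ≡-Reasoning
  open +-*-Solver
  l = length ps
  rest : Fin n → ℕ
  rest v = length (filter (v ∉?_) ps)

-- Sum the bound size (delete G v) ≤ ex over all v: each edge of G avoids all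
-- but three vertices.
ex-averaging : ∀ {m} (F : 3-Graph m) F≢∅ k →
  ex (4 ℕ.+ k) F F≢∅ ℕ.* (1 ℕ.+ k) ℕ.≤ ex (3 ℕ.+ k) F F≢∅ ℕ.* (4 ℕ.+ k)
ex-averaging F F≢∅ k = subst (λ e → e ℕ.* (1 ℕ.+ k) ℕ.≤ ex (3 ℕ.+ k) F F≢∅ ℕ.* (4 ℕ.+ k)) ∣G∣≡
  (ℕ.+-cancelʳ-≤ (3 ℕ.* size G) _ _ (begin
  size G ℕ.* (1 ℕ.+ k) ℕ.+ 3 ℕ.* size G
    ≡⟨ solve 2 (λ g k → g :* (con 1 :+ k) :+ con 3 :* g := (con 4 :+ k) :* g) refl (size G) k ⟩
  (4 ℕ.+ k) ℕ.* size G
    ≡⟨ sum-avoiding (edges G) (uniform G) ⟨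
  sum (λ v → length (avoiding G v)) ℕ.+ 3 ℕ.* size G
    ≤⟨ ℕ.+-monoˡ-≤ (3 ℕ.* size G) (sum-mono below) ⟩
  (4 ℕ.+ k) ℕ.* ex (3 ℕ.+ k) F F≢∅ ℕ.+ 3 ℕ.* size G
    ≡⟨ cong (ℕ._+ 3 ℕ.* size G) (ℕ.*-comm (4 ℕ.+ k) (ex (3 ℕ.+ k) F F≢∅)) ⟩
  ex (3 ℕ.+ k) F F≢∅ ℕ.* (4 ℕ.+ k) ℕ.+ 3 ℕ.* size G ∎))
  where
  open ℕ.≤-Reasoning
  open +-*-Solver
  attained = proj₁ (proj₂ (turán-number F F≢∅ (4 ℕ.+ k)))
  G = proj₁ attained
  ¬F⊑G = proj₁ (proj₂ attained)
  ∣G∣≡ = proj₂ (proj₂ attained)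
  below : ∀ v → length (avoiding G v) ℕ.≤ ex (3 ℕ.+ k) F F≢∅
  below v = ℕ.≤-trans (ℕ.≤-reflexive (sym (length-map _ (avoiding G v))))
    (proj₂ (proj₂ (turán-number F F≢∅ (3 ℕ.+ k))) (delete G v) (delete-free G v {F = F} ¬F⊑G))

2*nC2 : ∀ k → 2 ℕ.* ((1 ℕ.+ k) C 2) ≡ (1 ℕ.+ k) ℕ.* k
2*nC2 zero    = refl
2*nC2 (suc k) = begin
  2 ℕ.* ((2 ℕ.+ k) C 2)
    ≡⟨ cong (2 ℕ.*_) (sym (nCk+nC[k+1]≡[n+1]C[k+1] (1 ℕ.+ k) 1)) ⟩
  2 ℕ.* ((1 ℕ.+ k) C 1 ℕ.+ (1 ℕ.+ k) C 2)
    ≡⟨ ℕ.*-distribˡ-+ 2 ((1 ℕ.+ k) C 1) _ ⟩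
  2 ℕ.* ((1 ℕ.+ k) C 1) ℕ.+ 2 ℕ.* ((1 ℕ.+ k) C 2)
    ≡⟨ cong₂ (λ a b → 2 ℕ.* a ℕ.+ b) (nC1≡n (1 ℕ.+ k)) (2*nC2 k) ⟩
  2 ℕ.* (1 ℕ.+ k) ℕ.+ (1 ℕ.+ k) ℕ.* k
    ≡⟨ solve 1 (λ k → con 2 :* (con 1 :+ k) :+ (con 1 :+ k) :* k := (con 2 :+ k) :* (con 1 :+ k)) refl k ⟩
  (2 ℕ.+ k) ℕ.* (1 ℕ.+ k) ∎
  where
  open ≡-Reasoning
  open +-*-Solver

6*nC3 : ∀ k → 6 ℕ.* ((2 ℕ.+ k) C 3) ≡ (2 ℕ.+ k) ℕ.* (1 ℕ.+ k) ℕ.* k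
6*nC3 zero    = refl
6*nC3 (suc k) = begin
  6 ℕ.* ((3 ℕ.+ k) C 3)
    ≡⟨ cong (6 ℕ.*_) (sym (nCk+nC[k+1]≡[n+1]C[k+1] (2 ℕ.+ k) 2)) ⟩
  6 ℕ.* ((2 ℕ.+ k) C 2 ℕ.+ (2 ℕ.+ k) C 3)
    ≡⟨ solve 2 (λ a b → con 6 :* (a :+ b) := con 3 :* (con 2 :* a) :+ con 6 :* b) refl ((2 ℕ.+ k) C 2) ((2 ℕ.+ k) C 3) ⟩
  3 ℕ.* (2 ℕ.* ((2 ℕ.+ k) C 2)) ℕ.+ 6 ℕ.* ((2 ℕ.+ k) C 3)
    ≡⟨ cong₂ (λ a b → 3 ℕ.* a ℕ.+ b) (2*nC2 (1 ℕ.+ k)) (6*nC3 k) ⟩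
  3 ℕ.* ((2 ℕ.+ k) ℕ.* (1 ℕ.+ k)) ℕ.+ (2 ℕ.+ k) ℕ.* (1 ℕ.+ k) ℕ.* k
    ≡⟨ solve 1 (λ k → con 3 :* ((con 2 :+ k) :* (con 1 :+ k)) :+ (con 2 :+ k) :* (con 1 :+ k) :* k
         := (con 3 :+ k) :* (con 2 :+ k) :* (con 1 :+ k)) refl k ⟩
  (3 ℕ.+ k) ℕ.* (2 ℕ.+ k) ℕ.* (1 ℕ.+ k) ∎
  where
  open ≡-Reasoning
  open +-*-Solver

nC3-ratio : ∀ k → ((4 ℕ.+ k) C 3) ℕ.* (1 ℕ.+ k) ≡ ((3 ℕ.+ k) C 3) ℕ.* (4 ℕ.+ k)
nC3-ratio k = ℕ.*-cancelˡ-≡ _ _ 6 (begin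
  6 ℕ.* (((4 ℕ.+ k) C 3) ℕ.* (1 ℕ.+ k))
    ≡⟨ sym (ℕ.*-assoc 6 ((4 ℕ.+ k) C 3) _) ⟩
  6 ℕ.* ((4 ℕ.+ k) C 3) ℕ.* (1 ℕ.+ k)
    ≡⟨ cong (ℕ._* (1 ℕ.+ k)) (6*nC3 (2 ℕ.+ k)) ⟩
  (4 ℕ.+ k) ℕ.* (3 ℕ.+ k) ℕ.* (2 ℕ.+ k) ℕ.* (1 ℕ.+ k)
    ≡⟨ solve 4 (λ a b c d → a :* b :* c :* d := b :* c :* d :* a) refl (4 ℕ.+ k) (3 ℕ.+ k) (2 ℕ.+ k) (1 ℕ.+ k) ⟩
  (3 ℕ.+ k) ℕ.* (2 ℕ.+ k) ℕ.* (1 ℕ.+ k) ℕ.* (4 ℕ.+ k)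
    ≡⟨ cong (ℕ._* (4 ℕ.+ k)) (sym (6*nC3 (1 ℕ.+ k))) ⟩
  6 ℕ.* ((3 ℕ.+ k) C 3) ℕ.* (4 ℕ.+ k)
    ≡⟨ ℕ.*-assoc 6 ((3 ℕ.+ k) C 3) _ ⟩
  6 ℕ.* (((3 ℕ.+ k) C 3) ℕ.* (4 ℕ.+ k)) ∎)
  where
  open ≡-Reasoning
  open +-*-Solver

nC3-nonZero : ∀ k → ℕ.NonZero ((3 ℕ.+ k) C 3)
nC3-nonZero k = ℕ.≢-nonZero λ eq → 0≢ (trans (cong (6 ℕ.*_) (sym eq)) (6*nC3 (1 ℕ.+ k)))
  where
  0≢ : ¬ 0 ≡ (3 ℕ.+ k) ℕ.* (2 ℕ.+ k) ℕ.* (1 ℕ.+ k)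
  0≢ ()

-- The index is shifted by 3 so that the binomial coefficients do not vanish.
density : ∀ {m} (F : 3-Graph m) → NonEmpty F → ℕ → ℚ
density F F≢∅ k = (+ ex (3 ℕ.+ k) F F≢∅ / ((3 ℕ.+ k) C 3)) {{nC3-nonZero k}}

/-mono-≤ : ∀ {a b c d} .{{_ : ℕ.NonZero b}} .{{_ : ℕ.NonZero d}} →
           a ℕ.* d ℕ.≤ c ℕ.* b → + a / b ℚ.≤ + c / d
/-mono-≤ {a} {suc b} {c} {suc d} ad≤cb = ℚ.toℚᵘ-cancel-≤ (begin
  ℚ.toℚᵘ (+ a / suc b)  ≃⟨ ℚ.toℚᵘ-fromℚᵘ (ℚᵘ.mkℚᵘ (+ a) b) ⟩
  ℚᵘ.mkℚᵘ (+ a) b       ≤⟨ ℚᵘ.*≤* (subst₂ ℤ._≤_ (ℤ.pos-* a (suc d)) (ℤ.pos-* c (suc b)) (ℤ.+≤+ ad≤cb)) ⟩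
  ℚᵘ.mkℚᵘ (+ c) d       ≃⟨ ℚ.toℚᵘ-fromℚᵘ (ℚᵘ.mkℚᵘ (+ c) d) ⟨
  ℚ.toℚᵘ (+ c / suc d)  ∎)
  where open ℚᵘ.≤-Reasoning

density-nonNeg : ∀ {m} (F : 3-Graph m) F≢∅ k → 0ℚ ℚ.≤ density F F≢∅ k
density-nonNeg F F≢∅ k = /-mono-≤ {0} {1} {ex (3 ℕ.+ k) F F≢∅} {(3 ℕ.+ k) C 3} {{_}} {{nC3-nonZero k}} z≤n

density-antitone : ∀ {m} (F : 3-Graph m) F≢∅ k → density F F≢∅ (suc k) ℚ.≤ density F F≢∅ k
density-antitone F F≢∅ k = /-mono-≤ {e₄} {c₄} {e₃} {c₃} {{nC3-nonZero (suc k)}} {{nC3-nonZero k}} (ℕ.*-cancelʳ-≤ (e₄ ℕ.* c₃) (e₃ ℕ.* c₄) (1 ℕ.+ k) (begin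
  e₄ ℕ.* c₃ ℕ.* (1 ℕ.+ k)    ≡⟨ swap e₄ c₃ (1 ℕ.+ k) ⟩
  e₄ ℕ.* (1 ℕ.+ k) ℕ.* c₃    ≤⟨ ℕ.*-monoˡ-≤ c₃ (ex-averaging F F≢∅ k) ⟩
  e₃ ℕ.* (4 ℕ.+ k) ℕ.* c₃    ≡⟨ trans (ℕ.*-assoc e₃ _ c₃) (cong (e₃ ℕ.*_) (ℕ.*-comm (4 ℕ.+ k) c₃)) ⟩
  e₃ ℕ.* (c₃ ℕ.* (4 ℕ.+ k))  ≡⟨ cong (e₃ ℕ.*_) (sym (nC3-ratio k)) ⟩
  e₃ ℕ.* (c₄ ℕ.* (1 ℕ.+ k))  ≡⟨ sym (ℕ.*-assoc e₃ c₄ _) ⟩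
  e₃ ℕ.* c₄ ℕ.* (1 ℕ.+ k)    ∎))
  where
  open ℕ.≤-Reasoning
  e₄ = ex (4 ℕ.+ k) F F≢∅
  e₃ = ex (3 ℕ.+ k) F F≢∅
  c₃ = (3 ℕ.+ k) C 3
  c₄ = (4 ℕ.+ k) C 3
  swap : ∀ a b c → a ℕ.* b ℕ.* c ≡ a ℕ.* c ℕ.* b
  swap a b c = trans (ℕ.*-assoc a b c) (trans (cong (a ℕ.*_) (ℕ.*-comm b c)) (sym (ℕ.*-assoc a c b)))

-- The double negation makes this the classical notion: constructively, a
-- bounded monotone sequence need not have a modulus of convergence.
Cauchy : (ℕ → ℚ) → Set
Cauchy a = ∀ ε → 0ℚ ℚ.< ε →
  ¬ ¬ (∃ λ N → ∀ i j → N ℕ.≤ i → N ℕ.≤ j → ℚ.∣ a i ℚ.- a j ∣ ℚ.< ε)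

-- A real number is presented as the limit of a Cauchy sequence of rationals.
-- Distinct sequences may present the same real number: equality of reals is
-- mutual _≤ᴿ_.
record ℝ : Set where
  constructor lim
  field
    seq    : ℕ → ℚ
    cauchy : Cauchy seq

open ℝ public

infix 4 _≤ᴿ_

_≤ᴿ_ : ℝ → ℝ → Set
x ≤ᴿ y = ∀ ε → 0ℚ ℚ.< ε → ∃ λ N → ∀ n → N ℕ.≤ n → seq x n ℚ.≤ seq y n ℚ.+ ε

fromℚ : ℚ → ℝ
fromℚ q = lim (const q) λ ε 0<ε ¬c →
  ¬c (0 , λ _ _ _ _ → subst (λ z → ℚ.∣ z ∣ ℚ.< ε) (sym (ℚ.+-inverseʳ q)) 0<ε)

abstract
  ι : ℕ → ℚ
  ι j = + j / 1

  ι-zero : ι 0 ≡ 0ℚ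
  ι-zero = refl

  ι-suc : ∀ j → ι (suc j) ≡ ℚ.1ℚ ℚ.+ ι j
  ι-suc j = ℚ.toℚᵘ-injective (begin
    ℚ.toℚᵘ (ι (suc j))                   ≈⟨ ℚ.toℚᵘ-fromℚᵘ (ℚᵘ.mkℚᵘ (+ suc j) 0) ⟩
    ℚᵘ.mkℚᵘ (+ suc j) 0                  ≈⟨ ℚᵘ.*≡* (cong (λ z → (+ 1 ℤ.+ z) ℤ.* + 1) (sym (ℤ.*-identityʳ (+ j)))) ⟩
    ℚᵘ.1ℚᵘ ℚᵘ.+ ℚᵘ.mkℚᵘ (+ j) 0          ≈⟨ ℚᵘ.+-congʳ ℚᵘ.1ℚᵘ (ℚ.toℚᵘ-fromℚᵘ (ℚᵘ.mkℚᵘ (+ j) 0)) ⟨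
    ℚ.toℚᵘ ℚ.1ℚ ℚᵘ.+ ℚ.toℚᵘ (ι j)        ≈⟨ ℚ.toℚᵘ-homo-+ ℚ.1ℚ (ι j) ⟨
    ℚ.toℚᵘ (ℚ.1ℚ ℚ.+ ι j)                ∎)
    where open import Relation.Binary.Reasoning.Setoid ℚᵘ.≃-setoid

  <ι : ∀ r → ∃ λ j → r ℚ.< ι j
  <ι r@(ℚ.mkℚ n d _) = suc ℤ.∣ n ∣ , ℚ.toℚᵘ-cancel-< (ℚᵘ.<-respʳ-≃
    (ℚᵘ.≃-sym (ℚ.toℚᵘ-fromℚᵘ (ℚᵘ.mkℚᵘ (+ suc ℤ.∣ n ∣) 0)))
    (ℚᵘ.*<* (ℤ.<-≤-trans
      (subst (ℤ._< + suc ℤ.∣ n ∣) (sym (ℤ.*-identityʳ n)) (n< n))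
      (subst (+ suc ℤ.∣ n ∣ ℤ.≤_) (ℤ.pos-* (suc ℤ.∣ n ∣) (suc d)) (ℤ.+≤+ (ℕ.m≤m*n _ (suc d)))))))
    where
    n< : ∀ n → n ℤ.< + suc ℤ.∣ n ∣
    n< (+ n)    = ℤ.+<+ (ℕ.n<1+n n)
    n< -[1+ n ] = ℤ.-<+

archimedean : ∀ x ε → 0ℚ ℚ.< ε → ∃ λ j → x ℚ.< ι j ℚ.* ε
archimedean x ε 0<ε = let j , h = <ι (x ℚ.* ℚ.1/ ε) in j , (begin-strict
  x                       ≡⟨ ℚ.*-identityʳ x ⟨
  x ℚ.* ℚ.1ℚ              ≡⟨ cong (x ℚ.*_) (sym (ℚ.*-inverseˡ ε)) ⟩
  x ℚ.* (ℚ.1/ ε ℚ.* ε)    ≡⟨ ℚ.*-assoc x (ℚ.1/ ε) ε ⟨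
  x ℚ.* ℚ.1/ ε ℚ.* ε      <⟨ ℚ.*-monoˡ-<-pos ε h ⟩
  ι j ℚ.* ε               ∎)
  where
  open ℚ.≤-Reasoning
  instance
    ε⁺ : ℚ.Positive ε
    ε⁺ = ℚ.positive 0<ε
    ε≢0 : ℚ.NonZero ε
    ε≢0 = ℚ.pos⇒nonZero ε

<+⇒-< : ∀ {x y ε} → x ℚ.< y ℚ.+ ε → x ℚ.- y ℚ.< ε
<+⇒-< {x} {y} {ε} h = begin-strict
  x ℚ.- y            <⟨ ℚ.+-monoˡ-< (ℚ.- y) h ⟩
  y ℚ.+ ε ℚ.- y      ≡⟨ cong (ℚ._- y) (ℚ.+-comm y ε) ⟩
  ε ℚ.+ y ℚ.- y      ≡⟨ ℚ.+-assoc ε y (ℚ.- y) ⟩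
  ε ℚ.+ (y ℚ.- y)    ≡⟨ cong (ε ℚ.+_) (ℚ.+-inverseʳ y) ⟩
  ε ℚ.+ 0ℚ           ≡⟨ ℚ.+-identityʳ ε ⟩
  ε                  ∎
  where open ℚ.≤-Reasoning

∣x-y∣<ε : ∀ {x y ε} → x ℚ.< y ℚ.+ ε → y ℚ.< x ℚ.+ ε → ℚ.∣ x ℚ.- y ∣ ℚ.< ε
∣x-y∣<ε {x} {y} {ε} h h′ with ℚ.∣p∣≡p∨∣p∣≡-p (x ℚ.- y)
... | inj₁ eq = subst (ℚ._< ε) (sym eq) (<+⇒-< h)
... | inj₂ eq = subst (ℚ._< ε) (sym (trans eq (⁻¹-anti-homo-// x y))) (<+⇒-< h′)

descent : ∀ x y z q ε → x ℚ.+ ε ℚ.≤ y → y ℚ.+ q ℚ.* ε ℚ.≤ z → x ℚ.+ (ℚ.1ℚ ℚ.+ q) ℚ.* ε ℚ.≤ z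
descent x y z q ε h h′ = begin
  x ℚ.+ (ℚ.1ℚ ℚ.+ q) ℚ.* ε         ≡⟨ cong (x ℚ.+_) (ℚ.*-distribʳ-+ ε ℚ.1ℚ q) ⟩
  x ℚ.+ (ℚ.1ℚ ℚ.* ε ℚ.+ q ℚ.* ε)   ≡⟨ cong (λ w → x ℚ.+ (w ℚ.+ q ℚ.* ε)) (ℚ.*-identityˡ ε) ⟩
  x ℚ.+ (ε ℚ.+ q ℚ.* ε)            ≡⟨ ℚ.+-assoc x ε (q ℚ.* ε) ⟨
  x ℚ.+ ε ℚ.+ q ℚ.* ε              ≤⟨ ℚ.+-monoˡ-≤ (q ℚ.* ε) h ⟩
  y ℚ.+ q ℚ.* ε                    ≤⟨ h′ ⟩
  z                                ∎
  where open ℚ.≤-Reasoning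

module _ (a : ℕ → ℚ) (0≤a : ∀ n → 0ℚ ℚ.≤ a n) (step : ∀ n → a (suc n) ℚ.≤ a n) where

  antitone : ∀ {m n} → m ℕ.≤′ n → a n ℚ.≤ a m
  antitone (ℕ.≤′-reflexive refl) = ℚ.≤-refl
  antitone (ℕ.≤′-step m≤n)       = ℚ.≤-trans (step _) (antitone m≤n)

  module _ (ε : ℚ) (¬cauchy : ¬ ∃ λ N → ∀ i j → N ℕ.≤ i → N ℕ.≤ j → ℚ.∣ a i ℚ.- a j ∣ ℚ.< ε) where

    Dropped : ℚ → Set
    Dropped q = ∃ λ N → a N ℚ.+ q ℚ.* ε ℚ.≤ a 0

    drop : ∀ q → ¬ Dropped (ℚ.1ℚ ℚ.+ q) → ¬ Dropped q
    drop q ¬next (N , h) = ¬cauchy (N , λ i j N≤i N≤j → ∣x-y∣<ε {a i} {a j} {ε}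
      (ℚ.≤-<-trans (antitone (ℕ.≤⇒≤′ N≤i)) (below j))
      (ℚ.≤-<-trans (antitone (ℕ.≤⇒≤′ N≤j)) (below i)))
      where
      below : ∀ n → a N ℚ.< a n ℚ.+ ε
      below n = ℚ.≰⇒> λ h′ → ¬next (n , descent (a n) (a N) (a 0) q ε h′ h)

    iterate : ∀ k → ¬ ¬ Dropped (ι k)
    iterate zero    ¬h = ¬h (0 , ℚ.≤-reflexive (begin
      a 0 ℚ.+ ι 0 ℚ.* ε   ≡⟨ cong (λ q → a 0 ℚ.+ q ℚ.* ε) ι-zero ⟩
      a 0 ℚ.+ 0ℚ ℚ.* ε    ≡⟨ cong (a 0 ℚ.+_) (ℚ.*-zeroˡ ε) ⟩
      a 0 ℚ.+ 0ℚ          ≡⟨ ℚ.+-identityʳ (a 0) ⟩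
      a 0                 ∎))
      where open ≡-Reasoning
    iterate (suc k) ¬h = iterate k (drop (ι k) (subst (λ q → ¬ Dropped q) (ι-suc k) ¬h))

  antitone⇒cauchy : Cauchy a
  antitone⇒cauchy ε 0<ε ¬cauchy = iterate ε ¬cauchy k λ (N , h) → ℚ.<-irrefl refl (ℚ.<-≤-trans a₀<kε (begin
    ι k ℚ.* ε          ≡⟨ ℚ.+-identityˡ (ι k ℚ.* ε) ⟨
    0ℚ ℚ.+ ι k ℚ.* ε   ≤⟨ ℚ.+-monoˡ-≤ (ι k ℚ.* ε) (0≤a N) ⟩
    a N ℚ.+ ι k ℚ.* ε  ≤⟨ h ⟩
    a 0                ∎))
    where
    open ℚ.≤-Reasoning
    k = proj₁ (archimedean (a 0) ε 0<ε)
    a₀<kε = proj₂ (archimedean (a 0) ε 0<ε)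

π : ∀ {m} (F : 3-Graph m) → NonEmpty F → ℝ
π F F≢∅ = lim (density F F≢∅)
  (antitone⇒cauchy _ (density-nonNeg F F≢∅) (density-antitone F F≢∅))

{-# OPTIONS --safe #-}

-- Put N = 2 s - 1. As s ≢ 0 mod 3, there is a Steiner triple system on N points
-- (Bose for N ≡ 3, Skolem for N ≡ 1 mod 6), regarded as an operation · with
-- x · y the third point of the block through x and y. Take N parts, join
-- vertices of three distinct parts that do not form a block, and iterate inside
-- every part. A clique in the link of a vertex of part i either lies inside part
-- i or meets distinct parts j ≢ i, no two of which are matched by j ↦ i · j; in
-- the second case it has at most (N - 1) / 2 = s - 1 vertices. With n = N ^ k
-- vertices the iterated 3-graph has (1 - 2 / s) (n³ - n) / 6 edges, and the
-- density decreases with n, so its values at n = N ^ k suffice.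
module Submission where

open import Defs
open import Data.Bool.Properties using () renaming (_≟_ to _≟ᵇ_)
open import Data.Empty using (⊥)
open import Data.Fin.Base using (Fin; zero; suc; toℕ; combine; punchIn; punchOut; remQuot; quotient; remainder)
open import Data.Fin.Permutation using (cast-id)
open import Data.Fin.Properties using (0≢1+n; suc-injective; toℕ-injective; toℕ-fromℕ<; toℕ<n; toℕ-cast;
  toℕ-combine; combine-injective; remQuot-combine; punchIn-punchOut; injective⇒≤; *↔×; +↔⊎)
  renaming (_≟_ to _≟ᶠ_)
open import Data.Fin.Subset using (Subset; inside; outside; ⁅_⁆; _∪_; _∈_; _∉_; ∣_∣)
open import Data.Fin.Subset.Properties using (x∈⁅x⁆; x∈⁅y⁆⇒x≡y; x∈p∪q⁻; x∈p∪q⁺; ∣⁅x⁆∣≡1; ∪-identityˡ)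
open import Data.Integer.Base using (+_)
import Data.Integer.Solver as ℤ
open import Data.List.Base using (List; []; _∷_; map; filter; length; _++_; allFin; cartesianProduct; deduplicate)
open import Data.List.Membership.Propositional using () renaming (_∈_ to _∈ˡ_)
open import Data.List.Membership.Propositional.Properties using (∈-map⁺; ∈-map⁻; ∈-++⁺ˡ; ∈-++⁺ʳ; ∈-++⁻;
  ∈-filter⁺; ∈-filter⁻; ∈-allFin; ∈-cartesianProduct⁺; ∈-cartesianProduct⁻; ∈-deduplicate⁺; ∈-deduplicate⁻)
open import Data.List.Properties using (length-++; length-map; length-tabulate)
open import Data.List.Relation.Unary.All as All using (All; []; _∷_)
import Data.List.Relation.Unary.All.Properties as All
open import Data.List.Relation.Unary.AllPairs using ([])
open import Data.List.Relation.Unary.Any using (here; there)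
import Data.List.Relation.Unary.Unique.DecPropositional.Properties as UniqueDec
open import Data.List.Relation.Unary.Unique.Propositional using (Unique)
import Data.List.Relation.Unary.Unique.Propositional.Properties as Unique
open import Data.Nat.Base as ℕ using (ℕ; zero; suc; _+_; _*_; _∸_; _^_; _≤_; _<_; _%_; z≤n; s≤s; z<s; NonZero; >-nonZero)
open import Data.Nat.Combinatorics using (_C_)
open import Data.Nat.DivMod using (_mod_; m≡m%n+[m/n]*n; m%n%n≡m%n; m<n⇒m%n≡m; [m+n]%n≡m%n; [m+kn]%n≡m%n;
  %-distribˡ-+; %-distribˡ-*)
open import Data.Nat.Properties using (≤-trans; ≤-reflexive; <⇒≤; <⇒≱; ≤⇒≤′; m≤m+n; m≤n+m; +-comm; +-mono-≤;
  +-monoˡ-≤; +-monoʳ-≤; +-cancelʳ-≤; *-comm; *-suc; *-monoˡ-≤; *-monoʳ-≤; *-cancelˡ-≤; m+[n∸m]≡n; m+n∸m≡n; ∸-monoˡ-≤;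
  module ≤-Reasoning)
open import Data.Nat.Solver using (module +-*-Solver)
open import Data.Product.Algebra using (×-comm)
open import Data.Product.Base using (∃; _×_; _,_; proj₁; proj₂)
open import Data.Product.Function.NonDependent.Propositional using (_×-↔_)
open import Data.Product.Properties using (≡-dec; ,-injectiveˡ; ,-injectiveʳ)
open import Data.Rational.Base as ℚ using (0ℚ; 1ℚ; _-_; _/_)
import Data.Rational.Properties as ℚ
import Data.Rational.Unnormalised.Base as ℚᵘ
import Data.Rational.Unnormalised.Properties as ℚᵘ
open import Data.Sum.Base using (_⊎_; inj₁; inj₂; [_,_]′)
open import Data.Sum.Function.Propositional using (_⊎-↔_)
open import Data.Vec.Base using ([]; _∷_; here; there)
import Data.Vec.Properties as Vec
open import Function.Base using (_∘_; id)
open import Function.Bundles using (_↔_; Inverse; mk↔ₛ′)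
open import Function.Definitions using (Injective)
open import Function.Properties.Inverse using (↔-refl; ↔-sym; ↔-trans)
open import Relation.Binary.Definitions using (DecidableEquality)
open import Relation.Binary.PropositionalEquality
open import Relation.Nullary using (¬_; Dec; yes; no; ¬?; _×-dec_; contradiction)

-- Steiner triple systems

-- Idempotent totally symmetric quasigroups are Steiner triple systems in equational form: the sets
-- {x, y, x · y} with x ≢ y have three elements and cover each pair exactly once. Squares belong to
-- no block, and x · x = x is the usual convention.
record SteinerQuasigroup (A : Set) : Set where
  infixl 7 _·_
  field
    _·_        : A → A → A
    idem       : ∀ x → x · x ≡ x
    comm       : ∀ x y → x · y ≡ y · x
    involutive : ∀ x y → x · (x · y) ≡ y

-- E is empty if all elements are idempotent (Bose's case) and consists of the
-- point ∞ otherwise (Skolem's case); root e y is the second square root of y.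
record HalfIdempotent (X E : Set) : Set where
  infixl 7 _∙_ _\\_
  infix  4 _≟_
  field
    _∙_        : X → X → X
    _\\_       : X → X → X
    _≟_        : DecidableEquality X
    ∙-comm     : ∀ x y → x ∙ y ≡ y ∙ x
    ∙-\\       : ∀ x y → x ∙ (x \\ y) ≡ y
    \\-∙       : ∀ x y → x \\ (x ∙ y) ≡ y
    ∞-unique   : (e e′ : E) → e ≡ e′
    ∞          : ∀ x → x ∙ x ≢ x → E
    root       : E → X → X
    sq-idem    : ∀ x → (x ∙ x) ∙ (x ∙ x) ≡ x ∙ x
    root-sq    : ∀ e y → y ∙ y ≡ y → root e y ∙ root e y ≡ y
    root-≢     : ∀ e y → y ∙ y ≡ y → root e y ≢ y
    root-of-sq : ∀ e x → x ∙ x ≢ x → root e (x ∙ x) ≡ x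

-- The three levels in cyclic order

next : Fin 3 → Fin 3
next zero             = suc zero
next (suc zero)       = suc (suc zero)
next (suc (suc zero)) = zero

next³ : ∀ k → next (next (next k)) ≡ k
next³ zero             = refl
next³ (suc zero)       = refl
next³ (suc (suc zero)) = refl

-- On a 3-cycle two levels are equal or one is the successor of the other, so these cases are
-- exhaustive and mutually exclusive.
data Compare : Fin 3 → Fin 3 → Set where
  same  : ∀ {k} → Compare k k
  above : ∀ {k} → Compare k (next k)
  below : ∀ {k} → Compare (next k) k

compare : ∀ k l → Compare k l
compare zero             zero             = same
compare zero             (suc zero)       = above
compare zero             (suc (suc zero)) = below
compare (suc zero)       zero             = below
compare (suc zero)       (suc zero)       = same
compare (suc zero)       (suc (suc zero)) = above
compare (suc (suc zero)) zero             = above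
compare (suc (suc zero)) (suc zero)       = below
compare (suc (suc zero)) (suc (suc zero)) = same

-- `compare` does not reduce on a variable level; the three equations let `rewrite` evaluate it in
-- each direction.
compare-same : ∀ k → compare k k ≡ same
compare-same zero             = refl
compare-same (suc zero)       = refl
compare-same (suc (suc zero)) = refl

compare-above : ∀ k → compare k (next k) ≡ above
compare-above zero             = refl
compare-above (suc zero)       = refl
compare-above (suc (suc zero)) = refl

compare-below : ∀ k → compare (next k) k ≡ below
compare-below zero             = refl
compare-below (suc zero)       = refl
compare-below (suc (suc zero)) = refl

-- The Bose and Skolem constructions

module BoseSkolem {X E : Set} (H : HalfIdempotent X E) where

  open HalfIdempotent H

  Point : Set
  Point = (X × Fin 3) ⊎ E

  \\-of : ∀ {x y z} → x ∙ y ≡ z → x \\ z ≡ y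
  \\-of {x} {y} eq = trans (cong (x \\_) (sym eq)) (\\-∙ x y)

  ∙-of : ∀ {x y z} → x \\ z ≡ y → x ∙ y ≡ z
  ∙-of {x} {y} {z} eq = trans (cong (x ∙_) (sym eq)) (∙-\\ x z)

  -- The blocks are {(x , k), (y , k), (x ∙ y , next k)} for x ≢ y and, writing
  -- d = x ∙ x, either {(x , 0), (x , 1), (x , 2)} or {∞, (x , k), (d , next k)}
  -- according to whether d ≡ x; p · q is the third point of the block of p and q.
  level : ∀ x y → Fin 3 → Dec (x ≡ y) → Point
  level x y k (yes _) = inj₁ (x , k)
  level x y k (no _)  = inj₁ (x ∙ y , next k)

  -- For the points (x , k) and (y , next k): in general the third point is (z , k) with z the
  -- solution of x ∙ z = y. If this solution is x itself, then y = x ∙ x, and the block is the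
  -- vertical one when y = x and passes through ∞ otherwise.
  rise : ∀ x y → Fin 3 → Dec (x \\ y ≡ x) → Dec (x ≡ y) → Point
  rise x y k (no _)   _         = inj₁ (x \\ y , k)
  rise x y k (yes _)  (yes _)   = inj₁ (x , next (next k))
  rise x y k (yes eq) (no x≢y)  = inj₂ (∞ x λ eq′ → x≢y (trans (sym eq′) (∙-of eq)))

  -- An idempotent x can only be the upper point of a block through ∞. The lower point is then the
  -- other square root of x, on the level preceding k, which is `next (next k)`. A non-idempotent x
  -- is the lower point.
  tip : E → ∀ x → Fin 3 → Dec (x ∙ x ≡ x) → Point
  tip e x k (yes _) = inj₁ (root e x , next (next k))
  tip e x k (no _)  = inj₁ (x ∙ x , next k)

  pair : ∀ (x y : X) {k l} → Compare k l → Point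
  pair x y (same {k})  = level x y k (x ≟ y)
  pair x y (above {k}) = rise x y k (x \\ y ≟ x) (x ≟ y)
  pair x y (below {k}) = rise y x k (y \\ x ≟ y) (y ≟ x)

  infixl 7 _·_
  _·_ : Point → Point → Point
  inj₁ (x , k) · inj₁ (y , l) = pair x y (compare k l)
  inj₁ (x , k) · inj₂ e       = tip e x k (x ∙ x ≟ x)
  inj₂ e       · inj₁ (x , k) = tip e x k (x ∙ x ≟ x)
  inj₂ e       · inj₂ _       = inj₂ e

  level-≡ : ∀ x k → inj₁ (x , k) · inj₁ (x , k) ≡ inj₁ (x , k)
  level-≡ x k rewrite compare-same k with x ≟ x
  ... | yes _  = refl
  ... | no x≢x = contradiction refl x≢x

  level-≢ : ∀ {x y} k → x ≢ y → inj₁ (x , k) · inj₁ (y , k) ≡ inj₁ (x ∙ y , next k)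
  level-≢ {x} {y} k x≢y rewrite compare-same k with x ≟ y
  ... | yes x≡y = contradiction x≡y x≢y
  ... | no _    = refl

  rise-≢ : ∀ {x y z} k → x ∙ z ≡ y → z ≢ x → inj₁ (x , k) · inj₁ (y , next k) ≡ inj₁ (z , k)
  rise-≢ {x} {y} k refl z≢x rewrite compare-above k with x \\ y ≟ x
  ... | yes eq = contradiction (trans (sym (\\-of refl)) eq) z≢x
  ... | no _   = cong (λ z → inj₁ (z , k)) (\\-of refl)

  rise-idem : ∀ {x} k → x ∙ x ≡ x → inj₁ (x , k) · inj₁ (x , next k) ≡ inj₁ (x , next (next k))
  rise-idem {x} k eq rewrite compare-above k with x \\ x ≟ x | x ≟ x
  ... | no ¬eq | _      = contradiction (\\-of eq) ¬eq
  ... | yes _  | no x≢x = contradiction refl x≢x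
  ... | yes _  | yes _  = refl

  rise-∞ : ∀ {x y} k e → x ∙ x ≡ y → x ≢ y → inj₁ (x , k) · inj₁ (y , next k) ≡ inj₂ e
  rise-∞ {x} {y} k e eq x≢y rewrite compare-above k with x \\ y ≟ x | x ≟ y
  ... | no ¬eq | _       = contradiction (\\-of eq) ¬eq
  ... | yes _  | yes x≡y = contradiction x≡y x≢y
  ... | yes _  | no _    = cong inj₂ (∞-unique _ _)

  tip-idem : ∀ {x} k e → x ∙ x ≡ x → inj₂ e · inj₁ (x , k) ≡ inj₁ (root e x , next (next k))
  tip-idem {x} k e eq with x ∙ x ≟ x
  ... | yes _  = refl
  ... | no ¬eq = contradiction eq ¬eq

  tip-≢ : ∀ {x} k e → x ∙ x ≢ x → inj₂ e · inj₁ (x , k) ≡ inj₁ (x ∙ x , next k)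
  tip-≢ {x} k e ¬eq with x ∙ x ≟ x
  ... | yes eq = contradiction eq ¬eq
  ... | no _   = refl

  comm : ∀ p q → p · q ≡ q · p
  comm (inj₁ (x , k)) (inj₁ (y , l)) with compare k l
  comm (inj₁ (x , k)) (inj₁ (y , .k)) | same with x ≟ y
  ... | yes refl = sym (level-≡ x k)
  ... | no x≢y   = trans (cong (λ z → inj₁ (z , next k)) (∙-comm x y)) (sym (level-≢ k (≢-sym x≢y)))
  comm (inj₁ (x , k)) (inj₁ (y , .(next k))) | above rewrite compare-below k = refl
  comm (inj₁ (x , .(next l))) (inj₁ (y , l)) | below rewrite compare-above l = refl
  comm (inj₁ _) (inj₂ _) = refl
  comm (inj₂ _) (inj₁ _) = refl
  comm (inj₂ e) (inj₂ f) = cong inj₂ (∞-unique e f)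

  flip-below : ∀ x y k {r} → inj₁ (y , k) · inj₁ (x , next k) ≡ r → inj₁ (x , next k) · inj₁ (y , k) ≡ r
  flip-below x y k = trans (comm (inj₁ (x , next k)) (inj₁ (y , k)))

  -- Involutivity reduces to naming the third point r of the block of p and q and evaluating the two
  -- products p · q and p · r.
  involutive′ : ∀ p q {r} → p · q ≡ r → p · r ≡ q → p · (p · q) ≡ q
  involutive′ p q eq eq′ = trans (cong (p ·_) eq) eq′

  -- The level before k is `next (next k)`, so this is the vertical block entered by a rise from
  -- that level and read backwards.
  fall-idem : ∀ {x} k → x ∙ x ≡ x → inj₁ (x , k) · inj₁ (x , next (next k)) ≡ inj₁ (x , next k)
  fall-idem {x} k eq = subst
    (λ l → inj₁ (x , l) · inj₁ (x , next (next k)) ≡ inj₁ (x , next k)) (next³ k)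
    (flip-below x x (next (next k)) (trans (rise-idem (next (next k)) eq) (cong (λ l → inj₁ (x , next l)) (next³ k))))

  sq-≢ : ∀ {x y} → x ∙ x ≡ y → x ≢ y → x ∙ x ≢ x
  sq-≢ eq x≢y eq′ = x≢y (trans (sym eq′) eq)

  involutive : ∀ p q → p · (p · q) ≡ q
  involutive p@(inj₁ (x , k)) q@(inj₁ (y , l)) = go (compare k l)
    where
    go : ∀ {k l} → Compare k l → inj₁ (x , k) · (inj₁ (x , k) · inj₁ (y , l)) ≡ inj₁ (y , l)
    go (same {k}) with x ≟ y
    ... | yes refl = involutive′ (inj₁ (x , k)) _ (level-≡ x k) (level-≡ x k)
    ... | no x≢y   = involutive′ (inj₁ (x , k)) (inj₁ (y , k)) (level-≢ k x≢y) (rise-≢ k refl (≢-sym x≢y))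
    go (above {k}) with x \\ y ≟ x | x ≟ y
    ... | no ¬eq | _       = involutive′ (inj₁ (x , k)) (inj₁ (y , next k)) (rise-≢ k (∙-\\ x y) ¬eq)
      (trans (level-≢ k (≢-sym ¬eq)) (cong (λ z → inj₁ (z , next k)) (∙-\\ x y)))
    ... | yes eq | yes refl = involutive′ (inj₁ (x , k)) (inj₁ (y , next k)) (rise-idem k (∙-of eq)) (fall-idem k (∙-of eq))
    ... | yes eq | no x≢y   = involutive′ (inj₁ (x , k)) (inj₁ (y , next k)) (rise-∞ k (∞ x (sq-≢ (∙-of eq) x≢y)) (∙-of eq) x≢y)
      (trans (tip-≢ k _ (sq-≢ (∙-of eq) x≢y)) (cong (λ z → inj₁ (z , next k)) (∙-of eq)))
    go (below {k}) with y \\ x ≟ y | y ≟ x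
    ... | no ¬eq | _       = involutive′ (inj₁ (x , next k)) (inj₁ (y , k)) (flip-below x y k (rise-≢ k (∙-\\ y x) ¬eq))
      (flip-below x (y \\ x) k (rise-≢ k (trans (∙-comm _ _) (∙-\\ y x)) (≢-sym ¬eq)))
    ... | yes eq | yes refl = involutive′ (inj₁ (x , next k)) (inj₁ (y , k)) (flip-below x y k (rise-idem k (∙-of eq)))
      (trans (rise-idem (next k) (∙-of eq)) (cong (λ l → inj₁ (x , l)) (next³ k)))
    -- Here x = y ∙ y is a square, hence idempotent, and its second square root is y. So the block
    -- through ∞ and (x , next k) leads back to (y , k).
    ... | yes eq | no y≢x   = involutive′ (inj₁ (x , next k)) (inj₁ (y , k)) (flip-below x y k (rise-∞ k e (∙-of eq) y≢x))
      (trans (tip-idem (next k) e idem)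
        (cong₂ (λ z l → inj₁ (z , l))
          (trans (cong (root e) (sym (∙-of eq))) (root-of-sq e y (sq-≢ (∙-of eq) y≢x))) (next³ k)))
      where
      e = ∞ y (sq-≢ (∙-of eq) y≢x)
      idem : x ∙ x ≡ x
      idem = subst (λ z → z ∙ z ≡ z) (∙-of eq) (sq-idem y)
  involutive (inj₁ (x , k)) (inj₂ e) with x ∙ x ≟ x
  -- Writing k as the successor of `next (next k)` shows the pair as a rise from the root to its
  -- square x, whose block contains ∞.
  ... | yes eq = trans (cong (λ l → inj₁ (x , l) · inj₁ (root e x , next (next k))) (sym (next³ k)))
    (flip-below x (root e x) (next (next k)) (rise-∞ (next (next k)) e (root-sq e x eq) (root-≢ e x eq)))
  ... | no ¬eq = rise-∞ k e refl (≢-sym ¬eq)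
  involutive (inj₂ e) (inj₁ (x , k)) with x ∙ x ≟ x
  ... | yes eq = trans (tip-≢ (next (next k)) e (sq-≢ (root-sq e x eq) (root-≢ e x eq)))
    (cong₂ (λ z l → inj₁ (z , l)) (root-sq e x eq) (next³ k))
  ... | no ¬eq = trans (tip-idem (next k) e (sq-idem x))
    (cong₂ (λ z l → inj₁ (z , l)) (root-of-sq e x ¬eq) (next³ k))
  involutive (inj₂ e) (inj₂ f) = cong inj₂ (∞-unique e f)

  steinerQuasigroup : SteinerQuasigroup Point
  steinerQuasigroup = record
    { _·_        = _·_
    ; idem       = λ { (inj₁ (x , k)) → level-≡ x k ; (inj₂ e) → refl }
    ; comm       = comm
    ; involutive = involutive
    }

-- Commutative quasigroups from cyclic groups

module Cyclic (n : ℕ) .{{_ : NonZero n}} where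

  open ≡-Reasoning

  toℕ-mod : ∀ m → toℕ (m mod n) ≡ m % n
  toℕ-mod m = toℕ-fromℕ< _

  mod-≡ : ∀ m (x : Fin n) → m % n ≡ toℕ x → m mod n ≡ x
  mod-≡ m x eq = toℕ-injective (trans (toℕ-mod m) eq)

  toℕ-% : ∀ (x : Fin n) → toℕ x % n ≡ toℕ x
  toℕ-% x = m<n⇒m%n≡m (toℕ<n x)

  +-%ʳ : ∀ a b → (a + b % n) % n ≡ (a + b) % n
  +-%ʳ a b = begin
    (a + b % n) % n          ≡⟨ %-distribˡ-+ a (b % n) n ⟩
    (a % n + b % n % n) % n  ≡⟨ cong (λ c → (a % n + c) % n) (m%n%n≡m%n b n) ⟩
    (a % n + b % n) % n      ≡⟨ %-distribˡ-+ a b n ⟨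
    (a + b) % n              ∎

  *-%ʳ : ∀ a b → (a * (b % n)) % n ≡ (a * b) % n
  *-%ʳ a b = begin
    (a * (b % n)) % n          ≡⟨ %-distribˡ-* a (b % n) n ⟩
    (a % n * (b % n % n)) % n  ≡⟨ cong (λ c → (a % n * c) % n) (m%n%n≡m%n b n) ⟩
    (a % n * (b % n)) % n      ≡⟨ %-distribˡ-* a b n ⟨
    (a * b) % n                ∎

  infixl 6 _⊕_ _⊖_
  _⊕_ _⊖_ : Fin n → Fin n → Fin n
  x ⊕ y = (toℕ x + toℕ y) mod n
  y ⊖ x = (toℕ y + (n ∸ toℕ x)) mod n

  ⊕-comm : ∀ x y → x ⊕ y ≡ y ⊕ x
  ⊕-comm x y = cong (_mod n) (+-comm (toℕ x) (toℕ y))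

  cancel : ∀ (x y : Fin n) → (toℕ x + (toℕ y + (n ∸ toℕ x))) % n ≡ toℕ y
  cancel x y = begin
    (toℕ x + (toℕ y + (n ∸ toℕ x))) % n  ≡⟨ cong (_% n) (solve 3 (λ a b c → a :+ (b :+ c) := b :+ (a :+ c)) refl (toℕ x) (toℕ y) _) ⟩
    (toℕ y + (toℕ x + (n ∸ toℕ x))) % n  ≡⟨ cong (λ m → (toℕ y + m) % n) (m+[n∸m]≡n (<⇒≤ (toℕ<n x))) ⟩
    (toℕ y + n) % n                      ≡⟨ [m+n]%n≡m%n (toℕ y) n ⟩
    toℕ y % n                            ≡⟨ toℕ-% y ⟩
    toℕ y                                ∎
    where open +-*-Solver

  ⊕-⊖ : ∀ x y → x ⊕ (y ⊖ x) ≡ y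
  ⊕-⊖ x y = mod-≡ _ _ (begin
    (toℕ x + toℕ (y ⊖ x)) % n                ≡⟨ cong (λ m → (toℕ x + m) % n) (toℕ-mod _) ⟩
    (toℕ x + (toℕ y + (n ∸ toℕ x)) % n) % n  ≡⟨ +-%ʳ (toℕ x) _ ⟩
    (toℕ x + (toℕ y + (n ∸ toℕ x))) % n      ≡⟨ cancel x y ⟩
    toℕ y                                    ∎)

  ⊖-⊕ : ∀ x y → (x ⊕ y) ⊖ x ≡ y
  ⊖-⊕ x y = mod-≡ _ _ (begin
    (toℕ (x ⊕ y) + (n ∸ toℕ x)) % n          ≡⟨ cong (λ m → (m + (n ∸ toℕ x)) % n) (toℕ-mod _) ⟩
    ((toℕ x + toℕ y) % n + (n ∸ toℕ x)) % n  ≡⟨ cong (_% n) (+-comm ((toℕ x + toℕ y) % n) _) ⟩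
    ((n ∸ toℕ x) + (toℕ x + toℕ y) % n) % n  ≡⟨ +-%ʳ (n ∸ toℕ x) _ ⟩
    ((n ∸ toℕ x) + (toℕ x + toℕ y)) % n      ≡⟨ cong (_% n) (solve 3 (λ a b c → c :+ (a :+ b) := a :+ (b :+ c)) refl (toℕ x) (toℕ y) _) ⟩
    (toℕ x + (toℕ y + (n ∸ toℕ x))) % n      ≡⟨ cancel x y ⟩
    toℕ y                                    ∎)
    where open +-*-Solver

  -- Summands are labelled by σ and sums by τ. Every pair of labellings turns addition in ℤ/n into a
  -- commutative quasigroup on X; which elements are idempotent depends on how σ and τ are matched.
  module Isotope {X : Set} (σ τ : X ↔ Fin n) where

    module σ = Inverse σ
    module τ = Inverse τ

    infixl 7 _∙_ _\\_
    _∙_ _\\_ : X → X → X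
    x ∙ y  = τ.from (σ.to x ⊕ σ.to y)
    x \\ y = σ.from (τ.to y ⊖ σ.to x)

    ∙-comm : ∀ x y → x ∙ y ≡ y ∙ x
    ∙-comm x y = cong τ.from (⊕-comm (σ.to x) (σ.to y))

    ∙-\\ : ∀ x y → x ∙ (x \\ y) ≡ y
    ∙-\\ x y = begin
      τ.from (σ.to x ⊕ σ.to (x \\ y))       ≡⟨ cong (λ z → τ.from (σ.to x ⊕ z)) (σ.strictlyInverseˡ _) ⟩
      τ.from (σ.to x ⊕ (τ.to y ⊖ σ.to x))   ≡⟨ cong τ.from (⊕-⊖ (σ.to x) (τ.to y)) ⟩
      τ.from (τ.to y)                       ≡⟨ τ.strictlyInverseʳ y ⟩
      y                                     ∎

    \\-∙ : ∀ x y → x \\ (x ∙ y) ≡ y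
    \\-∙ x y = begin
      σ.from (τ.to (x ∙ y) ⊖ σ.to x)          ≡⟨ cong (λ z → σ.from (z ⊖ σ.to x)) (τ.strictlyInverseˡ _) ⟩
      σ.from ((σ.to x ⊕ σ.to y) ⊖ σ.to x)     ≡⟨ cong σ.from (⊖-⊕ (σ.to x) (σ.to y)) ⟩
      σ.from (σ.to y)                         ≡⟨ σ.strictlyInverseʳ y ⟩
      y                                       ∎

-- On ℤ/n with n = 2t + 1 odd, x ∙ y = (x + y) / 2 is idempotent.
oddIdempotent : ∀ t → HalfIdempotent (Fin (1 + 2 * t)) (Fin 0)
oddIdempotent t = record
  { _∙_        = _∙_
  ; _\\_       = _\\_
  ; _≟_        = _≟ᶠ_
  ; ∙-comm     = ∙-comm
  ; ∙-\\       = ∙-\\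
  ; \\-∙       = \\-∙
  ; ∞-unique   = λ ()
  ; ∞          = λ x ¬idem → contradiction (halve-double x) ¬idem
  ; root       = λ ()
  ; sq-idem    = λ x → halve-double (x ∙ x)
  ; root-sq    = λ ()
  ; root-≢     = λ ()
  ; root-of-sq = λ ()
  }
  where
  n = 1 + 2 * t
  open Cyclic n
  open +-*-Solver
  open ≡-Reasoning
  halve double : Fin n → Fin n
  -- `suc t` is the inverse of 2 modulo 2 t + 1.
  halve x  = (suc t * toℕ x) mod n
  double x = x ⊕ x
  halve-double : ∀ x → halve (double x) ≡ x
  halve-double x = mod-≡ (suc t * toℕ (double x)) x (begin
    (suc t * toℕ (x ⊕ x)) % n              ≡⟨ cong (λ m → (suc t * m) % n) (toℕ-mod (toℕ x + toℕ x)) ⟩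
    (suc t * ((toℕ x + toℕ x) % n)) % n    ≡⟨ *-%ʳ (suc t) (toℕ x + toℕ x) ⟩
    (suc t * (toℕ x + toℕ x)) % n          ≡⟨ cong (_% n) (solve 2 (λ t x → (con 1 :+ t) :* (x :+ x) := x :+ x :* (con 1 :+ con 2 :* t)) refl t (toℕ x)) ⟩
    (toℕ x + toℕ x * n) % n                ≡⟨ [m+kn]%n≡m%n (toℕ x) (toℕ x) n ⟩
    toℕ x % n                              ≡⟨ toℕ-% x ⟩
    toℕ x                                  ∎)
  double-halve : ∀ x → double (halve x) ≡ x
  double-halve x = mod-≡ (toℕ (halve x) + toℕ (halve x)) x (begin
    (toℕ (halve x) + toℕ (halve x)) % n              ≡⟨ cong₂ (λ a b → (a + b) % n) (toℕ-mod (suc t * toℕ x)) (toℕ-mod (suc t * toℕ x)) ⟩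
    ((suc t * toℕ x) % n + (suc t * toℕ x) % n) % n  ≡⟨ %-distribˡ-+ (suc t * toℕ x) (suc t * toℕ x) n ⟨
    (suc t * toℕ x + suc t * toℕ x) % n              ≡⟨ cong (_% n) (solve 2 (λ t x → (con 1 :+ t) :* x :+ (con 1 :+ t) :* x := x :+ x :* (con 1 :+ con 2 :* t)) refl t (toℕ x)) ⟩
    (toℕ x + toℕ x * n) % n                          ≡⟨ [m+kn]%n≡m%n (toℕ x) (toℕ x) n ⟩
    toℕ x % n                                        ≡⟨ toℕ-% x ⟩
    toℕ x                                            ∎)
  open Isotope (↔-refl {A = Fin n}) (mk↔ₛ′ double halve double-halve halve-double)

-- The label (b , i) stands for the summand b t + i and for the sum 2 i + b in
-- ℤ/2t, so that both (0 , i) and (1 , i) have square (0 , i).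
evenHalfIdempotent : ∀ t .{{_ : NonZero t}} → HalfIdempotent (Fin 2 × Fin t) (Fin 1)
evenHalfIdempotent t@(suc _) = record
  { _∙_        = _∙_
  ; _\\_       = _\\_
  ; _≟_        = ≡-dec _≟ᶠ_ _≟ᶠ_
  ; ∙-comm     = ∙-comm
  ; ∙-\\       = ∙-\\
  ; \\-∙       = \\-∙
  ; ∞-unique   = λ { zero zero → refl }
  ; ∞          = λ _ _ → zero
  ; root       = λ { _ (_ , i) → suc zero , i }
  ; sq-idem    = λ x → trans (cong (λ y → y ∙ y) (square x)) (trans (square (zero , proj₂ x)) (sym (square x)))
  ; root-sq    = λ { _ (b , i) eq → trans (square (suc zero , i)) (trans (sym (square (b , i))) eq) }
  ; root-≢     = λ { _ (b , i) eq eq′ → contradiction (trans (cong proj₁ eq′) (trans (cong proj₁ (sym eq)) (cong proj₁ (square (b , i))))) λ () }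
  ; root-of-sq = λ { _ (zero , i)     ¬idem → contradiction (square (zero , i)) ¬idem
                   ; _ (suc zero , i) _     → cong (λ y → suc zero , proj₂ y) (square (suc zero , i)) }
  }
  where
  open Cyclic (2 * t)
  open +-*-Solver
  open ≡-Reasoning
  summand total : (Fin 2 × Fin t) ↔ Fin (2 * t)
  summand = ↔-sym *↔×
  total   = ↔-trans (↔-trans (×-comm (Fin 2) (Fin t)) (↔-sym *↔×)) (cast-id (*-comm t 2))
  open Isotope summand total
  -- Doubling b t + i gives 2 i + b (2 t), which is 2 i in ℤ/2t for both values of b; as a sum, 2 i
  -- carries the label (0 , i).
  square : ∀ x → x ∙ x ≡ (zero , proj₂ x)
  square (b , i) = trans (cong τ.from (mod-≡ (toℕ (combine b i) + toℕ (combine b i)) (τ.to (zero , i)) (begin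
    (toℕ (combine b i) + toℕ (combine b i)) % (2 * t)      ≡⟨ cong (λ m → (m + m) % (2 * t)) (toℕ-combine b i) ⟩
    ((t * toℕ b + toℕ i) + (t * toℕ b + toℕ i)) % (2 * t)  ≡⟨ cong (_% (2 * t)) (solve 3 (λ t b i → (t :* b :+ i) :+ (t :* b :+ i) := (con 2 :* i :+ con 0) :+ b :* (con 2 :* t)) refl t (toℕ b) (toℕ i)) ⟩
    (2 * toℕ i + 0 + toℕ b * (2 * t)) % (2 * t)            ≡⟨ [m+kn]%n≡m%n (2 * toℕ i + 0) (toℕ b) (2 * t) ⟩
    (2 * toℕ i + 0) % (2 * t)                              ≡⟨ cong (_% (2 * t)) (trans (toℕ-cast (*-comm t 2) (combine i (zero {1}))) (toℕ-combine i (zero {1}))) ⟨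
    toℕ (τ.to (zero , i)) % (2 * t)                        ≡⟨ toℕ-% (τ.to (zero , i)) ⟩
    toℕ (τ.to (zero , i))                                  ∎)))
    (τ.strictlyInverseʳ (zero , i))

-- Steiner triple systems of order 2 s - 1

transport : ∀ {A B : Set} → A ↔ B → SteinerQuasigroup A → SteinerQuasigroup B
transport A↔B Q = record
  { _·_        = λ x y → to (from x · from y)
  ; idem       = λ x → trans (cong to (idem (from x))) (strictlyInverseˡ x)
  ; comm       = λ x y → cong to (comm (from x) (from y))
  ; involutive = λ x y → trans (cong (λ z → to (from x · z)) (strictlyInverseʳ _))
      (trans (cong to (involutive (from x) (from y))) (strictlyInverseˡ y))
  }
  where
  open Inverse A↔B
  open SteinerQuasigroup Q

steinerQuasigroup-3[1+2t] : ∀ t → SteinerQuasigroup (Fin ((1 + 2 * t) * 3 + 0))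
steinerQuasigroup-3[1+2t] t =
  transport (↔-sym (↔-trans +↔⊎ (*↔× ⊎-↔ ↔-refl))) (BoseSkolem.steinerQuasigroup (oddIdempotent t))

steinerQuasigroup-1+6t : ∀ t .{{_ : NonZero t}} → SteinerQuasigroup (Fin (2 * t * 3 + 1))
steinerQuasigroup-1+6t t =
  transport (↔-sym (↔-trans +↔⊎ (↔-trans *↔× (*↔× ×-↔ ↔-refl) ⊎-↔ ↔-refl)))
    (BoseSkolem.steinerQuasigroup (evenHalfIdempotent t))

-- With s = 2 + p the order is 2 s - 1 = 3 + 2 p. It equals 6 t + 1 for s = 3 t + 1 (Skolem) and 6 t
-- + 3 for s = 3 t + 2 (Bose).
steinerQuasigroup : ∀ p → let s = 2 + p in s % 3 ≡ 1 ⊎ s % 3 ≡ 2 → SteinerQuasigroup (Fin (3 + 2 * p))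
steinerQuasigroup p (inj₁ s%3≡1) with (2 + p) ℕ./ 3 | trans (m≡m%n+[m/n]*n (2 + p) 3) (cong (_+ (2 + p) ℕ./ 3 * 3) s%3≡1)
-- The quotient cannot be zero, as that would give s = 1; so Skolem's parameter is positive.
... | suc t | refl = subst (λ n → SteinerQuasigroup (Fin n))
  (solve 1 (λ t → con 2 :* (con 1 :+ t) :* con 3 :+ con 1 := con 3 :+ con 2 :* (con 2 :+ t :* con 3)) refl t)
  (steinerQuasigroup-1+6t (suc t))
  where open +-*-Solver
steinerQuasigroup p (inj₂ s%3≡2) with (2 + p) ℕ./ 3 | trans (m≡m%n+[m/n]*n (2 + p) 3) (cong (_+ (2 + p) ℕ./ 3 * 3) s%3≡2)
... | t | refl = subst (λ n → SteinerQuasigroup (Fin n))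
  (solve 1 (λ t → (con 1 :+ con 2 :* t) :* con 3 :+ con 0 := con 3 :+ con 2 :* (t :* con 3)) refl t)
  (steinerQuasigroup-3[1+2t] t)
  where open +-*-Solver

-- 3-graphs given by ordered triples

-- Induction on `bs`: at most c elements lie over the head, and the others map into the tail. The
-- predicate P carries what the fibre bound has to know about the elements.
length≤fibre* : ∀ {A B : Set} (_≟_ : DecidableEquality B) {P : A → Set} (f : A → B) c →
  (∀ b {ms} → Unique ms → All (λ x → P x × f x ≡ b) ms → length ms ≤ c) →
  ∀ bs {xs} → Unique xs → All (λ x → P x × f x ∈ˡ bs) xs → length xs ≤ c * length bs
length≤fibre* _≟_ f c fibre []       _ []             = z≤n
length≤fibre* _≟_ f c fibre []       _ ((_ , ()) ∷ _)
length≤fibre* _≟_ {P} f c fibre (b ∷ bs) {xs} xs! h = begin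
  length xs                       ≤⟨ length-mono xs! split ⟩
  length (over ++ rest)           ≡⟨ length-++ over ⟩
  length over + length rest       ≤⟨ +-mono-≤
    (fibre b (Unique.filter⁺ over? xs!) (All.zip (All.map proj₁ (All.filter⁺ over? h) , All.all-filter over? xs)))
    (length≤fibre* _≟_ f c fibre bs (Unique.filter⁺ rest? xs!)
      (All.map keep (All.zip (All.filter⁺ rest? h , All.all-filter rest? xs)))) ⟩
  c + c * length bs               ≡⟨ *-suc c (length bs) ⟨
  c * length (b ∷ bs)             ∎
  where
  open ≤-Reasoning
  over? = λ x → f x ≟ b
  rest? = λ x → ¬? (over? x)
  over = filter over? xs
  rest = filter rest? xs
  keep : ∀ {x} → (P x × f x ∈ˡ b ∷ bs) × f x ≢ b → P x × f x ∈ˡ bs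
  keep ((px , here eq)  , ≢b) = contradiction eq ≢b
  keep ((px , there i) , _)   = px , i
  split : ∀ {x} → x ∈ˡ xs → x ∈ˡ over ++ rest
  split {x} x∈ with f x ≟ b
  ... | yes eq = ∈-++⁺ˡ (∈-filter⁺ over? x∈ eq)
  ... | no ¬eq = ∈-++⁺ʳ over (∈-filter⁺ rest? x∈ ¬eq)

∣⁅x⁆∪p∣ : ∀ {n} {x : Fin n} {p} → x ∉ p → ∣ ⁅ x ⁆ ∪ p ∣ ≡ suc ∣ p ∣
∣⁅x⁆∪p∣ {x = zero}  {inside ∷ p}  x∉p = contradiction here x∉p
∣⁅x⁆∪p∣ {x = zero}  {outside ∷ p} x∉p = cong (suc ∘ ∣_∣) (∪-identityˡ p)
∣⁅x⁆∪p∣ {x = suc x} {inside ∷ p}  x∉p = cong suc (∣⁅x⁆∪p∣ (x∉p ∘ there))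
∣⁅x⁆∪p∣ {x = suc x} {outside ∷ p} x∉p = ∣⁅x⁆∪p∣ (x∉p ∘ there)

∣⁅x⁆∪⁅y⁆∣ : ∀ {n} {x y : Fin n} → x ≢ y → ∣ ⁅ x ⁆ ∪ ⁅ y ⁆ ∣ ≡ 2
∣⁅x⁆∪⁅y⁆∣ {y = y} x≢y = trans (∣⁅x⁆∪p∣ (x≢y ∘ x∈⁅y⁆⇒x≡y y)) (cong suc (∣⁅x⁆∣≡1 y))

Triple : Set → Set
Triple V = V × V × V

module _ {V : Set} where

  Distinct : Triple V → Set
  Distinct (x , y , z) = x ≢ y × x ≢ z × y ≢ z

  arrangements : Triple V → List (Triple V)
  arrangements (u , v , w) =
    (u , v , w) ∷ (u , w , v) ∷ (v , u , w) ∷ (v , w , u) ∷ (w , u , v) ∷ (w , v , u) ∷ []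

  _∈₃_ : V → Triple V → Set
  x ∈₃ (u , v , w) = x ≡ u ⊎ x ≡ v ⊎ x ≡ w

  -- Distinctness forbids that two of x, y, z occupy the same entry of t, which leaves the six
  -- bijections.
  arrange : ∀ {t x y z} → Distinct (x , y , z) → x ∈₃ t → y ∈₃ t → z ∈₃ t → (x , y , z) ∈ˡ arrangements t
  arrange (x≢y , x≢z , y≢z) (inj₁ refl)        (inj₁ refl)        _                  = contradiction refl x≢y
  arrange (x≢y , x≢z , y≢z) (inj₁ refl)        (inj₂ _)           (inj₁ refl)        = contradiction refl x≢z
  arrange (x≢y , x≢z , y≢z) (inj₁ refl)        (inj₂ (inj₁ refl)) (inj₂ (inj₁ refl)) = contradiction refl y≢z
  arrange (x≢y , x≢z , y≢z) (inj₁ refl)        (inj₂ (inj₁ refl)) (inj₂ (inj₂ refl)) = here refl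
  arrange (x≢y , x≢z , y≢z) (inj₁ refl)        (inj₂ (inj₂ refl)) (inj₂ (inj₁ refl)) = there (here refl)
  arrange (x≢y , x≢z , y≢z) (inj₁ refl)        (inj₂ (inj₂ refl)) (inj₂ (inj₂ refl)) = contradiction refl y≢z
  arrange (x≢y , x≢z , y≢z) (inj₂ _)           (inj₁ refl)        (inj₁ refl)        = contradiction refl y≢z
  arrange (x≢y , x≢z , y≢z) (inj₂ (inj₁ refl)) (inj₁ refl)        (inj₂ (inj₁ refl)) = contradiction refl x≢z
  arrange (x≢y , x≢z , y≢z) (inj₂ (inj₁ refl)) (inj₁ refl)        (inj₂ (inj₂ refl)) = there (there (here refl))
  arrange (x≢y , x≢z , y≢z) (inj₂ (inj₁ refl)) (inj₂ (inj₁ refl)) _                  = contradiction refl x≢y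
  arrange (x≢y , x≢z , y≢z) (inj₂ (inj₁ refl)) (inj₂ (inj₂ refl)) (inj₁ refl)        = there (there (there (here refl)))
  arrange (x≢y , x≢z , y≢z) (inj₂ (inj₁ refl)) (inj₂ (inj₂ refl)) (inj₂ (inj₁ refl)) = contradiction refl x≢z
  arrange (x≢y , x≢z , y≢z) (inj₂ (inj₁ refl)) (inj₂ (inj₂ refl)) (inj₂ (inj₂ refl)) = contradiction refl y≢z
  arrange (x≢y , x≢z , y≢z) (inj₂ (inj₂ refl)) (inj₁ refl)        (inj₂ (inj₁ refl)) = there (there (there (there (here refl))))
  arrange (x≢y , x≢z , y≢z) (inj₂ (inj₂ refl)) (inj₁ refl)        (inj₂ (inj₂ refl)) = contradiction refl x≢z
  arrange (x≢y , x≢z , y≢z) (inj₂ (inj₂ refl)) (inj₂ (inj₁ refl)) (inj₁ refl)        = there (there (there (there (there (here refl)))))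
  arrange (x≢y , x≢z , y≢z) (inj₂ (inj₂ refl)) (inj₂ (inj₁ refl)) (inj₂ (inj₁ refl)) = contradiction refl y≢z
  arrange (x≢y , x≢z , y≢z) (inj₂ (inj₂ refl)) (inj₂ (inj₁ refl)) (inj₂ (inj₂ refl)) = contradiction refl x≢z
  arrange (x≢y , x≢z , y≢z) (inj₂ (inj₂ refl)) (inj₂ (inj₂ refl)) _                  = contradiction refl x≢y

module _ {n : ℕ} where

  ⟦_⟧ : Triple (Fin n) → Subset n
  ⟦ u , v , w ⟧ = ⁅ u ⁆ ∪ (⁅ v ⁆ ∪ ⁅ w ⁆)

  ∈⟦⟧⁻ : ∀ t {x} → x ∈ ⟦ t ⟧ → x ∈₃ t
  ∈⟦⟧⁻ (u , v , w) x∈ with x∈p∪q⁻ ⁅ u ⁆ _ x∈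
  ... | inj₁ x∈u = inj₁ (x∈⁅y⁆⇒x≡y u x∈u)
  ... | inj₂ x∈vw with x∈p∪q⁻ ⁅ v ⁆ ⁅ w ⁆ x∈vw
  ...   | inj₁ x∈v = inj₂ (inj₁ (x∈⁅y⁆⇒x≡y v x∈v))
  ...   | inj₂ x∈w = inj₂ (inj₂ (x∈⁅y⁆⇒x≡y w x∈w))

  ∈⟦⟧⁺ : ∀ t {x} → x ∈₃ t → x ∈ ⟦ t ⟧
  ∈⟦⟧⁺ (u , v , w) (inj₁ refl)        = x∈p∪q⁺ (inj₁ (x∈⁅x⁆ u))
  ∈⟦⟧⁺ (u , v , w) (inj₂ (inj₁ refl)) = x∈p∪q⁺ {p = ⁅ u ⁆} (inj₂ (x∈p∪q⁺ (inj₁ (x∈⁅x⁆ v))))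
  ∈⟦⟧⁺ (u , v , w) (inj₂ (inj₂ refl)) = x∈p∪q⁺ {p = ⁅ u ⁆} (inj₂ (x∈p∪q⁺ {p = ⁅ v ⁆} (inj₂ (x∈⁅x⁆ w))))

  ∣⟦⟧∣ : ∀ t → Distinct t → ∣ ⟦ t ⟧ ∣ ≡ 3
  ∣⟦⟧∣ (u , v , w) (u≢v , u≢w , v≢w) = trans (∣⁅x⁆∪p∣ u∉) (cong suc (∣⁅x⁆∪⁅y⁆∣ v≢w))
    where
    u∉ : u ∉ ⁅ v ⁆ ∪ ⁅ w ⁆
    u∉ u∈ with x∈p∪q⁻ ⁅ v ⁆ ⁅ w ⁆ u∈
    ... | inj₁ u∈v = u≢v (x∈⁅y⁆⇒x≡y v u∈v)
    ... | inj₂ u∈w = u≢w (x∈⁅y⁆⇒x≡y w u∈w)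

  arrange-⟦⟧ : ∀ {t t′} → Distinct t′ → ⟦ t′ ⟧ ≡ ⟦ t ⟧ → t′ ∈ˡ arrangements t
  arrange-⟦⟧ {t} {t′} d eq = arrange {t = t} d (into (inj₁ refl)) (into (inj₂ (inj₁ refl))) (into (inj₂ (inj₂ refl)))
    where
    into : ∀ {x} → x ∈₃ t′ → x ∈₃ t
    into x∈ = ∈⟦⟧⁻ t (subst (_ ∈_) eq (∈⟦⟧⁺ t′ x∈))

  -- All members of the fibre are arrangements of the first one, and there are six of these.
  ⟦⟧-fibre : ∀ e {ts} → Unique ts → All (λ t → Distinct t × ⟦ t ⟧ ≡ e) ts → length ts ≤ 6
  ⟦⟧-fibre e {[]}     _   _                 = z≤n
  ⟦⟧-fibre e {t ∷ ts} ts! h@((_ , eq) ∷ _) = length-mono ts! λ t′∈ →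
    let d , eq′ = All.lookup h t′∈ in arrange-⟦⟧ d (trans eq′ (sym eq))

  _≟ˢ_ : DecidableEquality (Subset n)
  _≟ˢ_ = Vec.≡-dec _≟ᵇ_

  module _ (ts : List (Triple (Fin n))) (distinct : All Distinct ts) where

    -- Ordered triples are convenient for counting. Different orders of one edge give the same
    -- subset, hence the deduplication.
    fromTriples : 3-Graph n
    fromTriples = record
      { edges   = deduplicate _≟ˢ_ (map ⟦_⟧ ts)
      ; unique  = UniqueDec.deduplicate-! _≟ˢ_ (map ⟦_⟧ ts)
      ; uniform = All.tabulate λ e∈ → uniform′ (∈-map⁻ ⟦_⟧ (∈-deduplicate⁻ _≟ˢ_ (map ⟦_⟧ ts) e∈))
      }
      where
      uniform′ : ∀ {e} → ∃ (λ t → t ∈ˡ ts × e ≡ ⟦ t ⟧) → ∣ e ∣ ≡ 3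
      uniform′ (t , t∈ , refl) = ∣⟦⟧∣ t (All.lookup distinct t∈)

    length≤6*size : Unique ts → length ts ≤ 6 * size fromTriples
    length≤6*size ts! = length≤fibre* _≟ˢ_ ⟦_⟧ 6 ⟦⟧-fibre (edges fromTriples) ts!
      (All.zip (distinct , All.tabulate λ t∈ → ∈-deduplicate⁺ _≟ˢ_ (∈-map⁺ ⟦_⟧ t∈)))

    -- The vertex v is the image of x⋆. The image of {x⋆, a, b} is the underlying set of some t in
    -- `ts`; as f is injective, (v , g a , g b) is an arrangement of t, and E holds for all of
    -- these.
    suspension⇒link-clique : ∀ (E : Triple (Fin n) → Set) → All (λ t → All E (arrangements t)) ts →
      ∀ s → S (K⁽²⁾ s) ⊑ fromTriples →
      ∃ λ v → ∃ λ (g : Fin s → Fin n) → ∀ a b → a ≢ b → E (v , g a , g b)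
    suspension⇒link-clique E closed s (f , inj , h) = f zero , f ∘ suc , λ a b a≢b →
      let p = ⁅ a ⁆ ∪ ⁅ b ⁆
          p∈ = subst (λ r → p ∈ˡ subsets r s) (∣⁅x⁆∪⁅y⁆∣ a≢b) (subsets-complete p)
          t , t∈ , eq = ∈-map⁻ ⟦_⟧ (∈-deduplicate⁻ _≟ˢ_ (map ⟦_⟧ ts) (All.lookup h (∈-map⁺ (inside ∷_) p∈)))
          into : ∀ {x} → x ∈ inside ∷ p → f x ∈₃ t
          into x∈ = ∈⟦⟧⁻ t (subst (_ ∈_) eq (∈-image⁺ {f = f} x∈))
      in All.lookup (All.lookup closed t∈) (arrange {t = t}
        ((λ q → 0≢1+n (inj q)) , (λ q → 0≢1+n (inj q)) , λ q → a≢b (suc-injective (inj q)))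
        (into here) (into (there (x∈p∪q⁺ (inj₁ (x∈⁅x⁆ a))))) (into (there (x∈p∪q⁺ {p = ⁅ a ⁆} (inj₂ (x∈⁅x⁆ b))))))

-- The iterated blow-up

length-cartesianProduct : ∀ {A B : Set} (xs : List A) (ys : List B) →
  length (cartesianProduct xs ys) ≡ length xs * length ys
length-cartesianProduct []       ys = refl
length-cartesianProduct (x ∷ xs) ys = trans (length-++ (map (x ,_) ys))
  (cong₂ _+_ (length-map (x ,_) ys) (length-cartesianProduct xs ys))

length-allFin : ∀ n → length (allFin n) ≡ n
length-allFin n = length-tabulate id

triples : ∀ n → List (Triple (Fin n))
triples n = cartesianProduct (allFin n) (cartesianProduct (allFin n) (allFin n))

∈-triples : ∀ {n} (t : Triple (Fin n)) → t ∈ˡ triples n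
∈-triples (x , y , z) = ∈-cartesianProduct⁺ (∈-allFin x) (∈-cartesianProduct⁺ (∈-allFin y) (∈-allFin z))

triples-unique : ∀ n → Unique (triples n)
triples-unique n = Unique.cartesianProduct⁺ (Unique.allFin⁺ n) (Unique.cartesianProduct⁺ (Unique.allFin⁺ n) (Unique.allFin⁺ n))

length-triples : ∀ n → length (triples n) ≡ n * (n * n)
length-triples n = trans (length-cartesianProduct (allFin n) _)
  (cong₂ _*_ (length-allFin n) (trans (length-cartesianProduct (allFin n) _) (cong₂ _*_ (length-allFin n) (length-allFin n))))

module Blowup {N-1 : ℕ} (Q : SteinerQuasigroup (Fin (suc N-1))) where

  N : ℕ
  N = suc N-1

  open SteinerQuasigroup Q

  NonBlock : Triple (Fin N) → Set
  NonBlock t@(i , j , l) = Distinct t × i · j ≢ l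

  nonBlock? : ∀ t → Dec (NonBlock t)
  nonBlock? (i , j , l) = (¬? (i ≟ᶠ j) ×-dec ¬? (i ≟ᶠ l) ×-dec ¬? (j ≟ᶠ l)) ×-dec ¬? (i · j ≟ᶠ l)

  nonBlock-swapˡ : ∀ {i j l} → NonBlock (i , j , l) → NonBlock (j , i , l)
  nonBlock-swapˡ {i} {j} ((i≢j , i≢l , j≢l) , ij≢l) = (≢-sym i≢j , j≢l , i≢l) , ij≢l ∘ trans (comm i j)

  nonBlock-swapʳ : ∀ {i j l} → NonBlock (i , j , l) → NonBlock (i , l , j)
  nonBlock-swapʳ {i} {j} {l} ((i≢j , i≢l , j≢l) , ij≢l) =
    (i≢l , i≢j , ≢-sym j≢l) , λ il≡j → ij≢l (trans (cong (i ·_) (sym il≡j)) (involutive i l))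

  fixed⇒≡ : ∀ {i j} → i · j ≡ j → i ≡ j
  fixed⇒≡ {i} {j} eq = begin
    i            ≡⟨ involutive j i ⟨
    j · (j · i)  ≡⟨ cong (j ·_) (trans (comm j i) eq) ⟩
    j · j        ≡⟨ idem j ⟩
    j            ∎
    where open ≡-Reasoning

  -- The elements of a clique of the link of i and their partners i · j are distinct.
  nonBlock-clique : ∀ {s} i (g : Fin s → Fin N) → (∀ a → i ≢ g a) →
    (∀ a b → a ≢ b → NonBlock (i , g a , g b)) → s + s ≤ N
  nonBlock-clique {s} i g i≢g clique = injective⇒≤ λ {x} {y} eq →
    trans (sym (I.strictlyInverseʳ x)) (trans (cong I.from (h-inj (I.to x) (I.to y) eq)) (I.strictlyInverseʳ y))
    where
    module I = Inverse (+↔⊎ {s} {s})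
    h : Fin s ⊎ Fin s → Fin N
    h = [ g , (λ a → i · g a) ]′
    g-inj : ∀ a b → g a ≡ g b → a ≡ b
    g-inj a b eq with a ≟ᶠ b
    ... | yes a≡b = a≡b
    ... | no a≢b  = contradiction eq (proj₂ (proj₂ (proj₁ (clique a b a≢b))))
    partner≢ : ∀ a b → i · g a ≢ g b
    partner≢ a b with a ≟ᶠ b
    ... | yes refl = λ eq → i≢g a (fixed⇒≡ eq)
    ... | no a≢b   = proj₂ (clique a b a≢b)
    h-inj : ∀ x y → h x ≡ h y → x ≡ y
    h-inj (inj₁ a) (inj₁ b) eq = cong inj₁ (g-inj a b eq)
    h-inj (inj₁ a) (inj₂ b) eq = contradiction (sym eq) (partner≢ b a)
    h-inj (inj₂ a) (inj₁ b) eq = contradiction eq (partner≢ a b)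
    h-inj (inj₂ a) (inj₂ b) eq = cong inj₂ (g-inj a b
      (trans (sym (involutive i (g a))) (trans (cong (i ·_) eq) (involutive i (g b)))))

  nonBlocks : List (Triple (Fin N))
  nonBlocks = filter nonBlock? (triples N)

  nonBlocks-unique : Unique nonBlocks
  nonBlocks-unique = Unique.filter⁺ nonBlock? (triples-unique N)

  -- The remaining triples (x , y , z) are covered by four families: x = y, and for x ≢ y the cases
  -- z = x, z = y and z = x · y. In the last three, y runs through the values `punchIn x a`, which
  -- gives N (N - 1) triples each.
  length-nonBlocks : N * (N * N) ≤ length nonBlocks + (N * N + (N * N-1 + (N * N-1 + N * N-1)))
  length-nonBlocks = begin
    N * (N * N)                                    ≡⟨ length-triples N ⟨
    length (triples N)                             ≤⟨ length-mono (triples-unique N) (λ {t} _ → cover t) ⟩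
    length (nonBlocks ++ blocks)                   ≡⟨ length-++ nonBlocks ⟩
    length nonBlocks + length blocks               ≡⟨ cong (λ l → length nonBlocks + l) length-blocks ⟩
    length nonBlocks + (N * N + (N * N-1 + (N * N-1 + N * N-1)))  ∎
    where
    open ≤-Reasoning
    pairs : ∀ n → List (Fin N × Fin n)
    pairs n = cartesianProduct (allFin N) (allFin n)
    length-pairs : ∀ n → length (pairs n) ≡ N * n
    length-pairs n = trans (length-cartesianProduct (allFin N) (allFin n)) (cong₂ _*_ (length-allFin N) (length-allFin n))
    b₁ : Fin N × Fin N → Triple (Fin N)
    b₁ (x , z) = x , x , z
    b₂ b₃ b₄ : Fin N × Fin N-1 → Triple (Fin N)
    b₂ (x , a) = x , punchIn x a , x
    b₃ (x , a) = x , punchIn x a , punchIn x a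
    b₄ (x , a) = x , punchIn x a , x · punchIn x a
    blocks : List (Triple (Fin N))
    blocks = map b₁ (pairs N) ++ (map b₂ (pairs N-1) ++ (map b₃ (pairs N-1) ++ map b₄ (pairs N-1)))
    length-blocks : length blocks ≡ N * N + (N * N-1 + (N * N-1 + N * N-1))
    length-blocks = trans (length-++ (map b₁ (pairs N))) (cong₂ _+_ (trans (length-map b₁ (pairs N)) (length-pairs N))
      (trans (length-++ (map b₂ (pairs N-1))) (cong₂ _+_ (trans (length-map b₂ (pairs N-1)) (length-pairs N-1))
        (trans (length-++ (map b₃ (pairs N-1))) (cong₂ _+_ (trans (length-map b₃ (pairs N-1)) (length-pairs N-1))
          (trans (length-map b₄ (pairs N-1)) (length-pairs N-1)))))))
    ∈-pairs : ∀ {n} x (a : Fin n) → (x , a) ∈ˡ pairs n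
    ∈-pairs x a = ∈-cartesianProduct⁺ (∈-allFin x) (∈-allFin a)
    off : ∀ {x y z} (x≢y : x ≢ y) → Dec (z ≡ x) → Dec (z ≡ y) → Dec (x · y ≡ z) → (x , y , z) ∈ˡ nonBlocks ++ blocks
    off {x} {y} x≢y (yes refl) _ _ = ∈-++⁺ʳ nonBlocks (∈-++⁺ʳ (map b₁ (pairs N)) (∈-++⁺ˡ
      (subst (λ y → (x , y , x) ∈ˡ map b₂ (pairs N-1)) (punchIn-punchOut x≢y) (∈-map⁺ b₂ (∈-pairs x (punchOut x≢y))))))
    off {x} {y} x≢y (no _) (yes refl) _ = ∈-++⁺ʳ nonBlocks (∈-++⁺ʳ (map b₁ (pairs N)) (∈-++⁺ʳ (map b₂ (pairs N-1)) (∈-++⁺ˡ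
      (subst (λ y → (x , y , y) ∈ˡ map b₃ (pairs N-1)) (punchIn-punchOut x≢y) (∈-map⁺ b₃ (∈-pairs x (punchOut x≢y)))))))
    off {x} {y} x≢y (no _) (no _) (yes refl) = ∈-++⁺ʳ nonBlocks (∈-++⁺ʳ (map b₁ (pairs N)) (
      ∈-++⁺ʳ (map b₂ (pairs N-1)) (∈-++⁺ʳ (map b₃ (pairs N-1))
      (subst (λ y → (x , y , x · y) ∈ˡ map b₄ (pairs N-1)) (punchIn-punchOut x≢y) (∈-map⁺ b₄ (∈-pairs x (punchOut x≢y)))))))
    off x≢y (no z≢x) (no z≢y) (no xy≢z) = ∈-++⁺ˡ (∈-filter⁺ nonBlock? (∈-triples _)
      ((x≢y , ≢-sym z≢x , ≢-sym z≢y) , xy≢z))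
    cover : ∀ t → t ∈ˡ nonBlocks ++ blocks
    cover (x , y , z) with x ≟ᶠ y
    ... | yes refl = ∈-++⁺ʳ nonBlocks (∈-++⁺ˡ (∈-map⁺ b₁ (∈-pairs x z)))
    ... | no x≢y   = off x≢y (z ≟ᶠ x) (z ≟ᶠ y) (x · y ≟ᶠ z)

  -- Edges of the iterated 3-graph

  spread : ∀ {m} → Triple (Fin N) × Triple (Fin m) → Triple (Fin (N * m))
  spread ((i , j , l) , (a , b , c)) = combine i a , combine j b , combine l c

  spread-injective : ∀ {m} → Injective _≡_ _≡_ (spread {m})
  spread-injective {m} {(i , j , l) , (a , b , c)} {(i′ , j′ , l′) , (a′ , b′ , c′)} eq
    with combine-injective i a i′ a′ (,-injectiveˡ eq)
       | combine-injective j b j′ b′ (,-injectiveˡ (,-injectiveʳ eq))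
       | combine-injective l c l′ c′ (,-injectiveʳ (,-injectiveʳ eq))
  ... | refl , refl | refl , refl | refl , refl = refl

  diagonal : Fin N → Triple (Fin N)
  diagonal i = i , i , i

  diagonal-injective : ∀ {i j} → diagonal i ≡ diagonal j → i ≡ j
  diagonal-injective = ,-injectiveˡ

  BlowupOf : ∀ {m} → (Triple (Fin m) → Set) → Triple (Fin N × Fin m) → Set
  BlowupOf P ((i , a) , (j , b) , (l , c)) = (i ≡ j × i ≡ l × P (a , b , c)) ⊎ NonBlock (i , j , l)

  -- `remQuot` decodes a vertex as its part, one of N, and its position inside this part. Level 0 is
  -- a single vertex without edges.
  Edge : ∀ k → Triple (Fin (N ^ k)) → Set
  Edge zero    _           = ⊥
  Edge (suc k) (u , v , w) = BlowupOf (Edge k) (remQuot (N ^ k) u , remQuot (N ^ k) v , remQuot (N ^ k) w)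

  edge-distinct : ∀ k {t} → Edge k t → Distinct t
  edge-distinct (suc k) (inj₁ (_ , _ , e)) = let u≢v , u≢w , v≢w = edge-distinct k e in
    u≢v ∘ cong (remainder {N} (N ^ k)) , u≢w ∘ cong (remainder {N} (N ^ k)) , v≢w ∘ cong (remainder {N} (N ^ k))
  edge-distinct (suc k) (inj₂ ((u≢v , u≢w , v≢w) , _)) =
    u≢v ∘ cong (quotient {N} (N ^ k)) , u≢w ∘ cong (quotient {N} (N ^ k)) , v≢w ∘ cong (quotient {N} (N ^ k))

  edge-swapˡ : ∀ k {u v w} → Edge k (u , v , w) → Edge k (v , u , w)
  edge-swapˡ (suc k) (inj₁ (u≡v , u≡w , e)) = inj₁ (sym u≡v , trans (sym u≡v) u≡w , edge-swapˡ k e)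
  edge-swapˡ (suc k) (inj₂ nb)              = inj₂ (nonBlock-swapˡ nb)

  edge-swapʳ : ∀ k {u v w} → Edge k (u , v , w) → Edge k (u , w , v)
  edge-swapʳ (suc k) (inj₁ (u≡v , u≡w , e)) = inj₁ (u≡w , u≡v , edge-swapʳ k e)
  edge-swapʳ (suc k) (inj₂ nb)              = inj₂ (nonBlock-swapʳ nb)

  edge-arrangements : ∀ k {t} → Edge k t → All (Edge k) (arrangements t)
  edge-arrangements k e = e ∷ ʳ e ∷ ˡ e ∷ ʳ (ˡ e) ∷ ˡ (ʳ e) ∷ ˡ (ʳ (ˡ e)) ∷ []
    where
    ˡ : ∀ {u v w} → Edge k (u , v , w) → Edge k (v , u , w)
    ˡ = edge-swapˡ k
    ʳ : ∀ {u v w} → Edge k (u , v , w) → Edge k (u , w , v)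
    ʳ = edge-swapʳ k

  edge-spread : ∀ k {i j l a b c} → BlowupOf (Edge k) ((i , a) , (j , b) , (l , c)) →
    Edge (suc k) (spread ((i , j , l) , (a , b , c)))
  edge-spread k {i} {j} {l} {a} {b} {c} = subst (BlowupOf (Edge k))
    (sym (cong₂ _,_ (remQuot-combine i a) (cong₂ _,_ (remQuot-combine j b) (remQuot-combine l c))))

  -- A clique in the link of v either lies in the part of v or meets no part
  -- twice and avoids the part of v.
  link-clique-free : ∀ {s} → N < 2 + s + (2 + s) → ∀ k v (g : Fin (2 + s) → Fin (N ^ k)) →
    ¬ (∀ a b → a ≢ b → Edge k (v , g a , g b))
  link-clique-free N<2s zero    v g clique = clique zero (suc zero) 0≢1+n
  -- An edge lies inside one part or meets three, so the part of `g zero` decides the case for every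
  -- other member of the clique.
  link-clique-free N<2s (suc k) v g clique with quotient {N} (N ^ k) v ≟ᶠ quotient {N} (N ^ k) (g zero)
  ... | yes qv≡qg₀ = link-clique-free N<2s k (remainder {N} (N ^ k) v) (remainder {N} (N ^ k) ∘ g)
    λ a b a≢b → within a (clique a b a≢b)
    where
    same-part : ∀ b → quotient {N} (N ^ k) v ≡ quotient {N} (N ^ k) (g b)
    same-part zero    = qv≡qg₀
    same-part (suc b) with clique zero (suc b) 0≢1+n
    ... | inj₁ (_ , eq , _)         = eq
    ... | inj₂ ((qv≢qg₀ , _) , _) = contradiction qv≡qg₀ qv≢qg₀
    within : ∀ a {w} → Edge (suc k) (v , g a , w) →
             Edge k (remainder {N} (N ^ k) v , remainder {N} (N ^ k) (g a) , remainder {N} (N ^ k) w)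
    within a (inj₁ (_ , _ , e))       = e
    within a (inj₂ ((qv≢qga , _) , _)) = contradiction (same-part a) qv≢qga
  ... | no qv≢qg₀ = <⇒≱ N<2s (nonBlock-clique (quotient {N} (N ^ k) v) (quotient {N} (N ^ k) ∘ g) other-part
    λ a b a≢b → across a (clique a b a≢b))
    where
    other-part : ∀ b → quotient {N} (N ^ k) v ≢ quotient {N} (N ^ k) (g b)
    other-part zero    = qv≢qg₀
    other-part (suc b) with clique zero (suc b) 0≢1+n
    ... | inj₁ (eq , _)               = contradiction eq qv≢qg₀
    ... | inj₂ ((_ , qv≢qgb , _) , _) = qv≢qgb
    across : ∀ a {w} → Edge (suc k) (v , g a , w) →
             NonBlock (quotient {N} (N ^ k) v , quotient {N} (N ^ k) (g a) , quotient {N} (N ^ k) w)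
    across a (inj₁ (eq , _)) = contradiction eq (other-part a)
    across a (inj₂ nb)       = nb

  -- The list is generated by recursion instead of being filtered by `Edge`, so that its length
  -- obeys a recurrence: the first product consists of the edges inside parts, the second of those
  -- across parts.
  edgeTriples : ∀ k → List (Triple (Fin (N ^ k)))
  edgeTriples zero    = []
  edgeTriples (suc k) = map spread
    (cartesianProduct (map diagonal (allFin N)) (edgeTriples k) ++ cartesianProduct nonBlocks (triples (N ^ k)))

  edgeTriples-unique : ∀ k → Unique (edgeTriples k)
  edgeTriples-unique zero    = []
  edgeTriples-unique (suc k) = Unique.map⁺ spread-injective (Unique.++⁺
    (Unique.cartesianProduct⁺ (Unique.map⁺ diagonal-injective (Unique.allFin⁺ N)) (edgeTriples-unique k))
    (Unique.cartesianProduct⁺ nonBlocks-unique (triples-unique (N ^ k)))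
    disjoint)
    where
    disjoint : ∀ {t} → ¬ (t ∈ˡ cartesianProduct (map diagonal (allFin N)) (edgeTriples k) ×
                          t ∈ˡ cartesianProduct nonBlocks (triples (N ^ k)))
    disjoint (t∈₁ , t∈₂)
      with ∈-map⁻ diagonal (proj₁ (∈-cartesianProduct⁻ (map diagonal (allFin N)) (edgeTriples k) t∈₁))
         | proj₂ (∈-filter⁻ nonBlock? {xs = triples N} (proj₁ (∈-cartesianProduct⁻ nonBlocks (triples (N ^ k)) t∈₂)))
    ... | _ , _ , refl | ((i≢i , _) , _) = i≢i refl

  edgeTriples-sound : ∀ k → All (Edge k) (edgeTriples k)
  edgeTriples-sound zero    = []
  edgeTriples-sound (suc k) = All.map⁺ (All.tabulate λ t∈ →
    sound ([ inj₁ ∘ ∈-cartesianProduct⁻ (map diagonal (allFin N)) (edgeTriples k)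
           , inj₂ ∘ ∈-cartesianProduct⁻ nonBlocks (triples (N ^ k)) ]′
      (∈-++⁻ (cartesianProduct (map diagonal (allFin N)) (edgeTriples k)) t∈)))
    where
    sound : ∀ {t t′} → (t ∈ˡ map diagonal (allFin N) × t′ ∈ˡ edgeTriples k) ⊎ (t ∈ˡ nonBlocks × t′ ∈ˡ triples (N ^ k)) →
            Edge (suc k) (spread (t , t′))
    sound (inj₁ (t∈ , t′∈)) with ∈-map⁻ diagonal t∈
    ... | i , _ , refl = edge-spread k {i} {i} {i} (inj₁ (refl , refl , All.lookup (edgeTriples-sound k) t′∈))
    sound (inj₂ (t∈ , _)) = edge-spread k (inj₂ (proj₂ (∈-filter⁻ nonBlock? {xs = triples N} t∈)))

  length-edgeTriples : ∀ k → let m = N ^ k in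
    length (edgeTriples (suc k)) ≡ N * length (edgeTriples k) + length nonBlocks * (m * (m * m))
  length-edgeTriples k = begin
    length (edgeTriples (suc k))  ≡⟨ length-map spread (inner ++ cross) ⟩
    length (inner ++ cross)       ≡⟨ length-++ inner ⟩
    length inner + length cross   ≡⟨ cong₂ _+_
      (trans (length-cartesianProduct (map diagonal (allFin N)) (edgeTriples k))
        (cong (_* length (edgeTriples k)) (trans (length-map diagonal (allFin N)) (length-allFin N))))
      (trans (length-cartesianProduct nonBlocks (triples (N ^ k)))
        (cong (length nonBlocks *_) (length-triples (N ^ k)))) ⟩
    N * length (edgeTriples k) + length nonBlocks * (N ^ k * (N ^ k * N ^ k))  ∎
    where
    open ≡-Reasoning
    inner = cartesianProduct (map diagonal (allFin N)) (edgeTriples k)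
    cross = cartesianProduct nonBlocks (triples (N ^ k))

  edgeTriples-distinct : ∀ k → All Distinct (edgeTriples k)
  edgeTriples-distinct k = All.map (edge-distinct k) (edgeTriples-sound k)

  blowup : ∀ k → 3-Graph (N ^ k)
  blowup k = fromTriples (edgeTriples k) (edgeTriples-distinct k)

  blowup-free : ∀ {s} → N < 2 + s + (2 + s) → ∀ k → ¬ S (K⁽²⁾ (2 + s)) ⊑ blowup k
  blowup-free {s} N<2s k copy =
    let v , g , clique = suspension⇒link-clique (edgeTriples k) (edgeTriples-distinct k) (Edge k)
          (All.map (edge-arrangements k) (edgeTriples-sound k)) (2 + s) copy
    in link-clique-free N<2s k v g clique

  length≤6*size-blowup : ∀ k → length (edgeTriples k) ≤ 6 * size (blowup k)
  length≤6*size-blowup k = length≤6*size (edgeTriples k) (edgeTriples-distinct k) (edgeTriples-unique k)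

-- Densities

1-2/s : ∀ p → 1ℚ - + 2 / (2 + p) ≡ + p / (2 + p)
1-2/s p = begin
  1ℚ - y              ≡⟨ cong (_- y) x+y≡1 ⟨
  x ℚ.+ y - y         ≡⟨ ℚ.+-assoc x y (ℚ.- y) ⟩
  x ℚ.+ (y - y)       ≡⟨ cong (x ℚ.+_) (ℚ.+-inverseʳ y) ⟩
  x ℚ.+ 0ℚ            ≡⟨ ℚ.+-identityʳ x ⟩
  x                   ∎
  where
  open ≡-Reasoning
  x = + p / (2 + p)
  y = + 2 / (2 + p)
  open ℤ.+-*-Solver
  x+y≡1 : x ℚ.+ y ≡ 1ℚ
  x+y≡1 = ℚ.toℚᵘ-injective (ℚᵘ.≃-trans (ℚ.toℚᵘ-homo-+ x y) (ℚᵘ.≃-trans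
    (ℚᵘ.+-cong (ℚ.toℚᵘ-fromℚᵘ (ℚᵘ.mkℚᵘ (+ p) (1 + p))) (ℚ.toℚᵘ-fromℚᵘ (ℚᵘ.mkℚᵘ (+ 2) (1 + p))))
    (ℚᵘ.*≡* (solve 1 (λ p → (p :* (con (+ 2) :+ p) :+ con (+ 2) :* (con (+ 2) :+ p)) :* con (+ 1)
      := con (+ 1) :* ((con (+ 2) :+ p) :* (con (+ 2) :+ p))) refl (+ p)))))

n<[2+a]^n : ∀ a n → n < (2 + a) ^ n
n<[2+a]^n a zero    = z<s
n<[2+a]^n a (suc n) = begin
  2 + n                                  ≡⟨ +-comm 1 (suc n) ⟩
  suc n + 1                              ≤⟨ +-mono-≤ (n<[2+a]^n a n) (≤-trans (s≤s z≤n) (n<[2+a]^n a n)) ⟩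
  (2 + a) ^ n + (2 + a) ^ n              ≤⟨ +-monoʳ-≤ ((2 + a) ^ n) (m≤m+n ((2 + a) ^ n) _) ⟩
  (2 + a) ^ suc n                        ∎
  where open ≤-Reasoning

module _ (p : ℕ) (Q : SteinerQuasigroup (Fin (3 + 2 * p))) where

  open Blowup {2 + 2 * p} Q
  open +-*-Solver
  open ≤-Reasoning

  -- Each of the N (N - 1) ordered pairs of distinct parts i, j leaves N - 3 = 2 p choices for the
  -- third part, which must avoid i, j and i · j.
  length-nonBlocks≥ : N * (2 + 2 * p) * (2 * p) ≤ length nonBlocks
  length-nonBlocks≥ = +-cancelʳ-≤ (N * N + (N * (2 + 2 * p) + (N * (2 + 2 * p) + N * (2 + 2 * p)))) _ _
    (subst (_≤ length nonBlocks + (N * N + (N * (2 + 2 * p) + (N * (2 + 2 * p) + N * (2 + 2 * p)))))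
      (solve 1 (λ p → let N = con 3 :+ con 2 :* p ; M = con 2 :+ con 2 :* p in
        N :* (N :* N) := N :* M :* (con 2 :* p) :+ (N :* N :+ (N :* M :+ (N :* M :+ N :* M)))) refl p)
      length-nonBlocks)

  -- This is the bound (1 - 2 / s) (m³ - m) on the number of ordered edges, with s = 2 + p, 1 - 2 /
  -- s = p / s, denominators cleared and the negative term moved to the other side.
  edgeTriples-cubic : ∀ k → let m = N ^ k in
    p * (m * (m * m)) ≤ (2 + p) * length (edgeTriples k) + p * m
  edgeTriples-cubic zero    = m≤n+m (p * 1) _
  edgeTriples-cubic (suc k) = begin
    p * (N * m * (N * m * (N * m)))
      -- Since 2 (2 + p) = N + 1, the second summand is p (N³ - N) m³: exactly what the edges across
      -- parts have to contribute.
      ≡⟨ solve 2 (λ p m → let N = con 3 :+ con 2 :* p ; M = m :* (m :* m) in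
           p :* (N :* m :* (N :* m :* (N :* m)))
             := N :* (p :* M) :+ (con 2 :+ p) :* ((N :* (con 2 :+ con 2 :* p) :* (con 2 :* p)) :* M)) refl p m ⟩
    N * (p * M) + (2 + p) * (N * (2 + 2 * p) * (2 * p) * M)
      ≤⟨ +-mono-≤ (*-monoʳ-≤ N (edgeTriples-cubic k)) (*-monoʳ-≤ (2 + p) (*-monoˡ-≤ M length-nonBlocks≥)) ⟩
    N * ((2 + p) * c + p * m) + (2 + p) * (t * M)
      ≡⟨ solve 5 (λ N p m c tM → N :* ((con 2 :+ p) :* c :+ p :* m) :+ (con 2 :+ p) :* tM
           := (con 2 :+ p) :* (N :* c :+ tM) :+ p :* (N :* m)) refl N p m c (t * M) ⟩
    (2 + p) * (N * c + t * M) + p * (N * m)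
      ≡⟨ cong (λ l → (2 + p) * l + p * (N * m)) (length-edgeTriples k) ⟨
    (2 + p) * length (edgeTriples (suc k)) + p * (N * m) ∎
    where
    m = N ^ k
    M = m * (m * m)
    c = length (edgeTriples k)
    t = length nonBlocks

  module _ (F≢∅ : NonEmpty (S (K⁽²⁾ (2 + p)))) where

    ex-cubic : ∀ k → let n = N ^ k in
      p * (n * (n * n)) ≤ (2 + p) * (6 * ex n (S (K⁽²⁾ (2 + p))) F≢∅) + p * n
    ex-cubic k = ≤-trans (edgeTriples-cubic k) (+-monoˡ-≤ (p * N ^ k) (*-monoʳ-≤ (2 + p) (begin
      length (edgeTriples k)                      ≤⟨ length≤6*size-blowup k ⟩
      6 * size (blowup k)                         ≤⟨ *-monoʳ-≤ 6 (proj₂ (proj₂ (turán-number _ F≢∅ (N ^ k))) (blowup k) (blowup-free N<2s k)) ⟩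
      6 * ex (N ^ k) (S (K⁽²⁾ (2 + p))) F≢∅       ∎)))
      where
      -- N = 2 s - 1 is the largest number of parts for which s parts and their s partners cannot
      -- all be distinct.
      N<2s : N < 2 + p + (2 + p)
      N<2s = ≤-reflexive (solve 1 (λ p → con 4 :+ con 2 :* p := con 2 :+ p :+ (con 2 :+ p)) refl p)

    cubic⇒density : ∀ k → let n = 3 + k in
      p * (n * (n * n)) ≤ (2 + p) * (6 * ex n (S (K⁽²⁾ (2 + p))) F≢∅) + p * n →
      + p / (2 + p) ℚ.≤ density (S (K⁽²⁾ (2 + p))) F≢∅ k
    cubic⇒density k h = /-mono-≤ {p} {2 + p} {e} {n C 3} {{_}} {{nC3-nonZero k}} (*-cancelˡ-≤ 6 (+-cancelʳ-≤ (p * n) _ _ (begin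
      6 * (p * (n C 3)) + p * n
        ≡⟨ cong (_+ p * n) (solve 2 (λ p c → con 6 :* (p :* c) := p :* (con 6 :* c)) refl p (n C 3)) ⟩
      p * (6 * (n C 3)) + p * n
        ≡⟨ cong (λ c → p * c + p * n) (6*nC3 (1 + k)) ⟩
      p * ((3 + k) * (2 + k) * (1 + k)) + p * n
        -- n³ - n exceeds n (n - 1) (n - 2) by 3 n (n - 1), which is n (6 + 3 k) for n = 3 + k.
        ≤⟨ m≤m+n _ (p * (n * (6 + 3 * k))) ⟩
      p * ((3 + k) * (2 + k) * (1 + k)) + p * n + p * (n * (6 + 3 * k))
        ≡⟨ solve 2 (λ p k → let n = con 3 :+ k in
             p :* (n :* (con 2 :+ k) :* (con 1 :+ k)) :+ p :* n :+ p :* (n :* (con 6 :+ con 3 :* k))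
               := p :* (n :* (n :* n))) refl p k ⟩
      p * (n * (n * n))
        ≤⟨ h ⟩
      (2 + p) * (6 * e) + p * n
        ≡⟨ cong (_+ p * n) (solve 2 (λ s e → s :* (con 6 :* e) := con 6 :* (e :* s)) refl (2 + p) e) ⟩
      6 * (e * (2 + p)) + p * n ∎)))
      where
      n = 3 + k
      e = ex n (S (K⁽²⁾ (2 + p))) F≢∅

    -- The density is antitone, so its value at k is at least its value at a later index that
    -- belongs to a power of N. The power N ^ (3 + k) is large enough, and 3 is subtracted because
    -- index k stands for 3 + k vertices.
    density≥ : ∀ k → + p / (2 + p) ℚ.≤ density (S (K⁽²⁾ (2 + p))) F≢∅ k
    density≥ k = ℚ.≤-trans
      (cubic⇒density k′ (subst (λ n → p * (n * (n * n)) ≤ (2 + p) * (6 * ex n (S (K⁽²⁾ (2 + p))) F≢∅) + p * n)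
        (sym (m+[n∸m]≡n (≤-trans (m≤m+n 3 k) 3+k≤))) (ex-cubic (3 + k))))
      (antitone (density (S (K⁽²⁾ (2 + p))) F≢∅) (density-nonNeg (S (K⁽²⁾ (2 + p))) F≢∅) (density-antitone (S (K⁽²⁾ (2 + p))) F≢∅)
        (≤⇒≤′ (subst (_≤ k′) (m+n∸m≡n 3 k) (∸-monoˡ-≤ 3 3+k≤))))
      where
      3+k≤ : 3 + k ≤ N ^ (3 + k)
      3+k≤ = <⇒≤ (n<[2+a]^n (1 + 2 * p) (3 + k))
      k′ = N ^ (3 + k) ∸ 3

corollary17 : (s : ℕ) (s≥2 : 2 ≤ s) → s % 3 ≡ 1 ⊎ s % 3 ≡ 2 →
    fromℚ (1ℚ - (+ 2 / s) {{>-nonZero (<⇒≤ s≥2)}})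
    ≤ᴿ π (S (K⁽²⁾ s)) (S-nonEmpty (K⁽²⁾ s) (K⁽²⁾-nonEmpty s s≥2))
-- The lower bound holds at every index, so the threshold is 0 for each ε.
corollary17 (suc (suc p)) s≥2@(s≤s (s≤s _)) s%3 ε 0<ε = 0 , λ n _ → begin
  1ℚ - + 2 / (2 + p)          ≡⟨ 1-2/s p ⟩
  + p / (2 + p)               ≤⟨ density≥ p (steinerQuasigroup p s%3) F≢∅ n ⟩
  density F F≢∅ n             ≡⟨ ℚ.+-identityʳ _ ⟨
  density F F≢∅ n ℚ.+ 0ℚ      ≤⟨ ℚ.+-monoʳ-≤ (density F F≢∅ n) (ℚ.<⇒≤ 0<ε) ⟩
  density F F≢∅ n ℚ.+ ε       ∎
  where
  open ℚ.≤-Reasoning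
  F = S (K⁽²⁾ (2 + p))
  F≢∅ = S-nonEmpty (K⁽²⁾ (2 + p)) (K⁽²⁾-nonEmpty (2 + p) s≥2)
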